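{- Let $G=G_{n,1/2}$ and let $X_n$ be the number of unordered partitions of $V(G)$ into two sets $\{A,B\}$ such that $G[A]$ and $G[B]$ both have all degrees even. Then for $0\le k\le n-1$, $$\Pr(X_n=2^k)=2^{ -\binom n2}\prod_{i=1}^{\lfloor (n-1-k)/2\rfloor}(1-2^{ -2i})^{ -1}\prod_{i=k+1}^{n-1}(2^i-1),$$ and $\Pr(X_n=x)=0$ if $x\neq 2^k$ for every such $k$.
   Context: $G_{n,1/2}$ is the binomial random graph on vertex set $[n]$ with each edge present independently with probability $1/2$. Empty products equal $1$. -}

module Defs where

open import Data.Bool using (Bool; true; false; _∧_)
open import Data.Nat using (ℕ; zero; suc; _+_; _*_; _∸_; _^_; _≤_; _<_; s≤s; z≤n; NonZero; >-nonZero)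
open import Data.Nat.Properties using (m^n>0; +-monoʳ-≤; ≤-trans)
open import Data.Nat.Divisibility using (_∣_; _∣?_)
open import Data.Nat.Combinatorics using (_C_)
open import Data.Fin using (Fin; zero; suc)
open import Data.Fin.Subset using (Subset; _∈_; ∁)
open import Data.Fin.Subset.Properties using (_∈?_)
open import Data.Fin.Properties using (all?)
open import Data.Vec using (Vec; []; _∷_; lookup)
open import Data.List using (List; []; _∷_; [_]; map; concatMap; filter; length; foldr; allFin)
open import Data.Product using (_×_; _,_)
open import Data.Unit using (⊤; tt)
open import Data.Integer using (+_)
open import Data.Rational using (ℚ; _/_; 1ℚ) renaming (_*_ to _*ℚ_)
open import Relation.Nullary using (Dec; _×-dec_)
import Data.Bool
import Data.Nat
import Data.Nat.Properties
open import Relation.Nullary.Decidable using (_→-dec_)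
open import Relation.Binary.PropositionalEquality using (_≡_)

allVecs : (n : ℕ) → List (Vec Bool n)
allVecs zero = [ [] ]
allVecs (suc n) = concatMap (λ v → (false ∷ v) ∷ (true ∷ v) ∷ []) (allVecs n)

-- A simple graph on vertex set Fin n: a graph on Fin n is built from a graph
-- on the vertices 1..n-1 (shifted) together with the adjacency vector of
-- vertex 0 to the other n-1 vertices. This is in bijection with the
-- 2^(n choose 2) simple graphs on n labelled vertices.
Graph : ℕ → Set
Graph zero = ⊤
Graph (suc n) = Graph n × Vec Bool n

adj : {n : ℕ} → Graph n → Fin n → Fin n → Bool
adj {suc n} (g , v) zero zero = false
adj {suc n} (g , v) zero (suc j) = lookup v j
adj {suc n} (g , v) (suc i) zero = lookup v i
adj {suc n} (g , v) (suc i) (suc j) = adj g i j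

allGraphs : (n : ℕ) → List (Graph n)
allGraphs zero = [ tt ]
allGraphs (suc n) = concatMap (λ g → map (λ v → (g , v)) (allVecs n)) (allGraphs n)

degIn : {n : ℕ} → Graph n → Subset n → Fin n → ℕ
degIn {n} g A v = length (filter (λ u → (adj g v u ∧ lookup A u) Data.Bool.≟ true) (allFin n))

EvenInduced : {n : ℕ} → Graph n → Subset n → Set
EvenInduced {n} g A = (v : Fin n) → v ∈ A → 2 ∣ degIn g A v

evenInduced? : {n : ℕ} (g : Graph n) (A : Subset n) → Dec (EvenInduced g A)
evenInduced? g A = all? (λ v → (v ∈? A) →-dec (2 ∣? degIn g A v))

GoodPart : {n : ℕ} → Graph n → Subset n → Set
GoodPart g A = EvenInduced g A × EvenInduced g (∁ A)

goodPart? : {n : ℕ} (g : Graph n) (A : Subset n) → Dec (GoodPart g A)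
goodPart? g A = evenInduced? g A ×-dec evenInduced? g (∁ A)

-- X_n(G): number of UNORDERED partitions {A , B} of V(G) with G[A], G[B]
-- both even.  Each unordered partition {A , V∖A} corresponds to exactly two
-- subsets A (namely A and V∖A, which are distinct when n ≥ 1), so the number
-- of unordered partitions is the number of such subsets divided by 2.
X : {n : ℕ} → Graph n → ℕ
X {n} g = Data.Nat._/_ (length (filter (goodPart? g) (allVecs n))) 2

-- Probability in G(n,1/2) that X_n = x: every graph has probability 2^{-(n C 2)}.
PrX≡ : (n x : ℕ) → ℚ
PrX≡ n x = _/_ (+ length (filter (λ g → X g Data.Nat.≟ x) (allGraphs n)))
           (2 ^ (n C 2)) {{Data.Nat.Properties.m^n≢0 2 (n C 2)}}

-- Product of f i for i = a, a+1, ..., b (empty, = 1, if b < a).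
prodFromTo : ℕ → ℕ → (ℕ → ℚ) → ℚ
prodFromTo a b f = foldr _*ℚ_ 1ℚ (map f (Data.List.applyUpTo (λ j → a + j) (suc b ∸ a)))

-- (1 - 2^{-2i})^{-1} = 2^{2i} / (2^{2i} - 1), for i ≥ 1 (value 1 at i = 0, unused).
private
  nz : (j : ℕ) → NonZero (2 ^ (2 * suc j) ∸ 1)
  nz j = >-nonZero (lem (2 * suc j) (s≤s z≤n))
    where
    lem : (m : ℕ) → 1 ≤ m → 1 ≤ 2 ^ m ∸ 1
    lem (suc m) _ = Data.Nat.Properties.∸-monoˡ-≤ 1 (Data.Nat.Properties.^-monoʳ-≤ 2 {1} {suc m} (s≤s z≤n))

invFactor : ℕ → ℚ
invFactor zero = 1ℚ
invFactor (suc j) = _/_ (+ (2 ^ (2 * suc j))) (2 ^ (2 * suc j) ∸ 1) {{nz j}}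

twoPowNeg : ℕ → ℚ
twoPowNeg m = _/_ (+ 1) (2 ^ m) {{Data.Nat.Properties.m^n≢0 2 m}}

-- 2^i - 1 as a rational (i ≥ 1 in all uses, so no truncation occurs).
twoPowMinusOne : ℕ → ℚ
twoPowMinusOne i = _/_ (+ (2 ^ i ∸ 1)) 1

{-# OPTIONS --safe #-}
module Submission where

-- Over 𝔽₂ let L be the Laplacian of G. A set A with indicator vector x is a good part iff L x = diag L.
-- The rows of L sum to 0, so deleting one vertex leaves a symmetric matrix M, which is uniformly distributed
-- and satisfies X = #{x : M x = diag M}. For symmetric M this system is always solvable (x ∙ M x = x ∙ diag M
-- makes the diagonal orthogonal to the kernel), so X = 2 ^ nullity M. The distribution of the nullity follows
-- by bordering M with a column v and a corner a: if v lies in the range of M, one value of a raises the nullity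
-- by one and the other keeps it; otherwise the nullity drops by one.

open import Defs
open import Data.Bool using (Bool; true; false; not; _∧_; _xor_)
import Data.Bool
open import Data.Bool.Properties using (xor-assoc; xor-comm; xor-same; xor-identityʳ; ∧-comm; ∧-zeroʳ; ∧-identityʳ; not-¬; ¬-not; not-involutive)
open import Data.Bool.Solver using (module xor-∧-Solver)
open import Data.Nat using (ℕ; zero; suc; _+_; _*_; _∸_; _^_; _/_; _<_; _≤_; _≟_; z≤n; s≤s; NonZero; ≢-nonZero⁻¹; >-nonZero; ⌊_/2⌋)
open import Data.Nat.Properties
open import Data.Nat.Combinatorics using (_C_)
open import Data.Nat.Divisibility using (_∣_; divides)
open import Data.Nat.DivMod using (m*n/n≡m; m/n≡1+[m∸n]/n)
open import Data.Nat.Primality using (prime[2]; euclidsLemma)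
open import Data.Nat.Solver using (module +-*-Solver)
import Data.Integer as ℤ
import Data.Integer.Properties as ℤ
open import Data.Rational using (ℚ; 0ℚ; 1ℚ; toℚᵘ) renaming (_*_ to _*ℚ_)
import Data.Rational as ℚ
import Data.Rational.Properties as ℚ
import Data.Rational.Solver as ℚ
open import Data.Rational.Unnormalised using (mkℚᵘ; *≡*) renaming (_≃_ to _≃ᵘ_)
import Data.Rational.Unnormalised.Properties as ℚᵘ
open import Data.Fin using (Fin; zero; suc)
open import Data.Fin.Subset using (Subset; _∈_; ∁)
open import Data.Vec using (Vec; []; _∷_; lookup; map; zipWith; replicate)
open import Data.Vec.Properties using (≡-dec; ∷-injective; zipWith-assoc; zipWith-comm; zipWith-identityˡ; zipWith-identityʳ; lookup-zipWith; lookup-map; lookup⇒[]=; []=⇒lookup)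
open import Data.List using (List; []; _∷_; _++_; concatMap; filter; length; tabulate; foldr; applyUpTo)
import Data.List as List
open import Data.Product using (_×_; _,_; ∃; proj₁; proj₂)
open import Data.Sum using (_⊎_; inj₁; inj₂)
open import Function using (_∘_)
open import Relation.Nullary using (¬_; Dec; yes; no; ¬?; contradiction)
open import Relation.Unary using (Pred; Decidable)
open import Relation.Binary.PropositionalEquality using (_≡_; _≢_; refl; sym; trans; cong; cong₂; subst; module ≡-Reasoning)

open ≡-Reasoning

-- Linear algebra over 𝔽₂

-- The equation L x = diag L merges both parity conditions. At a vertex of A it says that the degree
-- into A is even; at a vertex outside A it says that the degree into A has the parity of the full
-- degree, so that the degree into the complement is even. Passing from L to M also absorbs the
-- division by 2 in `X`: L is a bordering of M of the kind that doubles the solution count. No rank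
-- or dimension is defined. Nullity k appears as the solution count 2 ^ k, the range is measured by
-- its cardinality, and lying outside the range is certified by a kernel vector. The recursion for
-- the nullity has three terms whose closed forms carry different denominators, depending on the
-- parity of the rank; it is therefore solved over ℕ with denominators cleared, and rationals enter
-- only at the end.

infixl 6 _⊕_
infixl 7 _∙_ _⊙_

_⊕_ : ∀ {n} → Vec Bool n → Vec Bool n → Vec Bool n
_⊕_ = zipWith _xor_

_⊙_ : ∀ {n} → Bool → Vec Bool n → Vec Bool n
t ⊙ v = map (t ∧_) v

_∙_ : ∀ {n} → Vec Bool n → Vec Bool n → Bool
[] ∙ [] = false
(a ∷ x) ∙ (b ∷ y) = (a ∧ b) xor (x ∙ y)

𝟘 : ∀ {n} → Vec Bool n
𝟘 = replicate _ false

𝟙 : ∀ {n} → Vec Bool n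
𝟙 = replicate _ true

⊕-assoc : ∀ {n} (x y z : Vec Bool n) → (x ⊕ y) ⊕ z ≡ x ⊕ (y ⊕ z)
⊕-assoc = zipWith-assoc xor-assoc

⊕-comm : ∀ {n} (x y : Vec Bool n) → x ⊕ y ≡ y ⊕ x
⊕-comm = zipWith-comm xor-comm

⊕-identityˡ : ∀ {n} (x : Vec Bool n) → 𝟘 ⊕ x ≡ x
⊕-identityˡ = zipWith-identityˡ (λ _ → refl)

⊕-identityʳ : ∀ {n} (x : Vec Bool n) → x ⊕ 𝟘 ≡ x
⊕-identityʳ = zipWith-identityʳ xor-identityʳ

⊕-self : ∀ {n} (x : Vec Bool n) → x ⊕ x ≡ 𝟘
⊕-self [] = refl
⊕-self (a ∷ x) = cong₂ _∷_ (xor-same a) (⊕-self x)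

⊕-cancelˡ : ∀ {n} (x y : Vec Bool n) → x ⊕ (x ⊕ y) ≡ y
⊕-cancelˡ x y = begin
  x ⊕ (x ⊕ y)  ≡⟨ ⊕-assoc x x y ⟨
  (x ⊕ x) ⊕ y  ≡⟨ cong (_⊕ y) (⊕-self x) ⟩
  𝟘 ⊕ y        ≡⟨ ⊕-identityˡ y ⟩
  y            ∎

⊕-cancelʳ : ∀ {n} (x y : Vec Bool n) → (x ⊕ y) ⊕ y ≡ x
⊕-cancelʳ x y = begin
  (x ⊕ y) ⊕ y  ≡⟨ ⊕-assoc x y y ⟩
  x ⊕ (y ⊕ y)  ≡⟨ cong (x ⊕_) (⊕-self y) ⟩
  x ⊕ 𝟘        ≡⟨ ⊕-identityʳ x ⟩
  x            ∎

⊙-false : ∀ {n} (v : Vec Bool n) → false ⊙ v ≡ 𝟘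
⊙-false [] = refl
⊙-false (a ∷ v) = cong (false ∷_) (⊙-false v)

⊙-true : ∀ {n} (v : Vec Bool n) → true ⊙ v ≡ v
⊙-true [] = refl
⊙-true (a ∷ v) = cong (a ∷_) (⊙-true v)

⊙-distrib-xor : ∀ {n} (s t : Bool) (v : Vec Bool n) → (s xor t) ⊙ v ≡ s ⊙ v ⊕ t ⊙ v
⊙-distrib-xor s t [] = refl
⊙-distrib-xor s t (a ∷ v) = cong₂ _∷_
  (solve 3 (λ s t a → (s :+ t) :* a := s :* a :+ t :* a) refl s t a) (⊙-distrib-xor s t v)
  where open xor-∧-Solver

∙-comm : ∀ {n} (x y : Vec Bool n) → x ∙ y ≡ y ∙ x
∙-comm [] [] = refl
∙-comm (a ∷ x) (b ∷ y) = cong₂ _xor_ (∧-comm a b) (∙-comm x y)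

∙-zeroʳ : ∀ {n} (x : Vec Bool n) → x ∙ 𝟘 ≡ false
∙-zeroʳ [] = refl
∙-zeroʳ (a ∷ x) = cong₂ _xor_ (∧-zeroʳ a) (∙-zeroʳ x)

∙-distribˡ-⊕ : ∀ {n} (x y z : Vec Bool n) → x ∙ (y ⊕ z) ≡ (x ∙ y) xor (x ∙ z)
∙-distribˡ-⊕ [] [] [] = refl
∙-distribˡ-⊕ (a ∷ x) (b ∷ y) (c ∷ z) rewrite ∙-distribˡ-⊕ x y z =
  solve 5 (λ a b c p q → a :* (b :+ c) :+ (p :+ q) := (a :* b :+ p) :+ (a :* c :+ q))
    refl a b c (x ∙ y) (x ∙ z)
  where open xor-∧-Solver

∙-⊙ : ∀ {n} (x : Vec Bool n) (t : Bool) (y : Vec Bool n) → x ∙ (t ⊙ y) ≡ t ∧ (x ∙ y)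
∙-⊙ [] t [] = sym (∧-zeroʳ t)
∙-⊙ (a ∷ x) t (b ∷ y) rewrite ∙-⊙ x t y =
  solve 4 (λ a t b p → a :* (t :* b) :+ t :* p := t :* (a :* b :+ p)) refl a t b (x ∙ y)
  where open xor-∧-Solver

-- (g , d) encodes the symmetric matrix over 𝔽₂ that is the adjacency matrix of g
-- off the diagonal and d on it.
mul : ∀ {n} → Graph n → Vec Bool n → Vec Bool n → Vec Bool n
mul {zero} _ _ _ = []
mul {suc n} (g , v) (a ∷ d) (t ∷ x) = ((a ∧ t) xor (v ∙ x)) ∷ (t ⊙ v ⊕ mul g d x)

mul-⊕ : ∀ {n} (g : Graph n) (d x y : Vec Bool n) → mul g d (x ⊕ y) ≡ mul g d x ⊕ mul g d y
mul-⊕ {zero} g d x y = refl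
mul-⊕ {suc n} (g , v) (a ∷ d) (s ∷ x) (t ∷ y) = cong₂ _∷_ head tail
  where
  head : (a ∧ (s xor t)) xor (v ∙ (x ⊕ y)) ≡ ((a ∧ s) xor (v ∙ x)) xor ((a ∧ t) xor (v ∙ y))
  head rewrite ∙-distribˡ-⊕ v x y =
    solve 5 (λ a s t p q → a :* (s :+ t) :+ (p :+ q) := (a :* s :+ p) :+ (a :* t :+ q))
      refl a s t (v ∙ x) (v ∙ y)
    where open xor-∧-Solver
  interchange : ∀ {n} (p q r s : Vec Bool n) → (p ⊕ q) ⊕ (r ⊕ s) ≡ (p ⊕ r) ⊕ (q ⊕ s)
  interchange p q r s = begin
    (p ⊕ q) ⊕ (r ⊕ s)  ≡⟨ ⊕-assoc p q _ ⟩
    p ⊕ (q ⊕ (r ⊕ s))  ≡⟨ cong (p ⊕_) (⊕-assoc q r s) ⟨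
    p ⊕ ((q ⊕ r) ⊕ s)  ≡⟨ cong (λ z → p ⊕ (z ⊕ s)) (⊕-comm q r) ⟩
    p ⊕ ((r ⊕ q) ⊕ s)  ≡⟨ cong (p ⊕_) (⊕-assoc r q s) ⟩
    p ⊕ (r ⊕ (q ⊕ s))  ≡⟨ ⊕-assoc p r _ ⟨
    (p ⊕ r) ⊕ (q ⊕ s)  ∎
  tail : (s xor t) ⊙ v ⊕ mul g d (x ⊕ y) ≡ (s ⊙ v ⊕ mul g d x) ⊕ (t ⊙ v ⊕ mul g d y)
  tail rewrite ⊙-distrib-xor s t v | mul-⊕ g d x y = interchange (s ⊙ v) (t ⊙ v) _ _

mul-symmetric : ∀ {n} (g : Graph n) (d x y : Vec Bool n) → x ∙ mul g d y ≡ y ∙ mul g d x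
mul-symmetric {zero} g [] [] [] = refl
mul-symmetric {suc n} (g , v) (a ∷ d) (s ∷ x) (t ∷ y)
  rewrite ∙-distribˡ-⊕ x (t ⊙ v) (mul g d y) | ∙-distribˡ-⊕ y (s ⊙ v) (mul g d x)
        | ∙-⊙ x t v | ∙-⊙ y s v | ∙-comm v x | ∙-comm v y | mul-symmetric g d x y =
  solve 6 (λ s a t vy vx m → s :* (a :* t :+ vy) :+ (t :* vx :+ m)
                           := t :* (a :* s :+ vx) :+ (s :* vy :+ m))
    refl s a t (y ∙ v) (x ∙ v) (y ∙ mul g d x)
  where open xor-∧-Solver

-- In characteristic two the off-diagonal terms of a symmetric quadratic form cancel.
mul-quadratic : ∀ {n} (g : Graph n) (d x : Vec Bool n) → x ∙ mul g d x ≡ x ∙ d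
mul-quadratic {zero} g [] [] = refl
mul-quadratic {suc n} (g , v) (a ∷ d) (t ∷ x)
  rewrite ∙-distribˡ-⊕ x (t ⊙ v) (mul g d x) | ∙-⊙ x t v | ∙-comm v x | mul-quadratic g d x = go t
  where
  go : ∀ t → (t ∧ ((a ∧ t) xor (x ∙ v))) xor ((t ∧ (x ∙ v)) xor (x ∙ d)) ≡ (t ∧ a) xor (x ∙ d)
  go false = refl
  go true rewrite ∧-identityʳ a | sym (xor-assoc (a xor (x ∙ v)) (x ∙ v) (x ∙ d))
    | xor-assoc a (x ∙ v) (x ∙ v) | xor-same (x ∙ v) | xor-identityʳ a = refl

mul-false∷ : ∀ {n} (g : Graph n) (v : Vec Bool n) (a : Bool) (d x : Vec Bool n) →
  mul (g , v) (a ∷ d) (false ∷ x) ≡ (v ∙ x) ∷ mul g d x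
mul-false∷ g v a d x = cong₂ _∷_ (cong (_xor (v ∙ x)) (∧-zeroʳ a))
  (trans (cong (_⊕ mul g d x) (⊙-false v)) (⊕-identityˡ _))

mul-true∷ : ∀ {n} (g : Graph n) (v : Vec Bool n) (a : Bool) (d x : Vec Bool n) →
  mul (g , v) (a ∷ d) (true ∷ x) ≡ (a xor (v ∙ x)) ∷ (v ⊕ mul g d x)
mul-true∷ g v a d x = cong₂ _∷_ (cong (_xor (v ∙ x)) (∧-identityʳ a)) (cong (_⊕ mul g d x) (⊙-true v))

-- Solvability of symmetric systems

Solvable : ∀ {n} → Graph n → Vec Bool n → Vec Bool n → Set
Solvable g d b = ∃ λ x → mul g d x ≡ b

-- A positive certificate for lying outside the range: for a symmetric matrix the range is
-- orthogonal to the kernel, so a kernel vector pairing to `true` with `b` excludes every solution.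
Obstructed : ∀ {n} → Graph n → Vec Bool n → Vec Bool n → Set
Obstructed g d b = ∃ λ z → mul g d z ≡ 𝟘 × z ∙ b ≡ true

¬solvable∧obstructed : ∀ {n} (g : Graph n) (d b : Vec Bool n) → Obstructed g d b → ¬ Solvable g d b
¬solvable∧obstructed g d b (z , Mz≡𝟘 , zb≡1) (x , refl)
  with () ← trans (sym zb≡1) (trans (mul-symmetric g d z x) (trans (cong (x ∙_) Mz≡𝟘) (∙-zeroʳ x)))

∙-solved : ∀ {n} (g : Graph n) (d : Vec Bool n) {v y : Vec Bool n} → mul g d y ≡ v →
  ∀ x → v ∙ x ≡ y ∙ mul g d x
∙-solved g d {y = y} refl x = trans (∙-comm _ x) (mul-symmetric g d x y)

∙-adjust : ∀ {n} (v x z : Vec Bool n) → z ∙ v ≡ true → v ∙ (x ⊕ z) ≡ not (v ∙ x)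
∙-adjust v x z zv rewrite ∙-distribˡ-⊕ v x z | ∙-comm v z | zv with v ∙ x
... | false = refl
... | true = refl

mul-adjust : ∀ {n} (g : Graph n) (d x z : Vec Bool n) → mul g d z ≡ 𝟘 → mul g d (x ⊕ z) ≡ mul g d x
mul-adjust g d x z Mz rewrite mul-⊕ g d x z | Mz = ⊕-identityʳ _

-- Adding the kernel vector `z` flips the pairing with `v` and keeps the image. So when `v` is
-- outside the range, the first equation of a bordered system imposes no constraint.
shift-dot : ∀ {n} (g : Graph n) (d v : Vec Bool n) → Obstructed g d v → ∀ x (β : Bool) →
  ∃ λ x′ → mul g d x′ ≡ mul g d x × v ∙ x′ ≡ β
shift-dot g d v (z , Mz , zv) x β with v ∙ x in eq | β
... | false | false = x , refl , eq
... | true  | true  = x , refl , eq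
... | false | true  = x ⊕ z , mul-adjust g d x z Mz , trans (∙-adjust v x z zv) (cong not eq)
... | true  | false = x ⊕ z , mul-adjust g d x z Mz , trans (∙-adjust v x z zv) (cong not eq)

-- Induction by bordering produces a solution or a certificate directly, without elimination. The
-- cases follow whether the new column `v` is in the range of the smaller matrix.
fredholm : ∀ {n} (g : Graph n) (d b : Vec Bool n) → Solvable g d b ⊎ Obstructed g d b
fredholm {zero} g [] [] = inj₁ ([] , refl)
fredholm {suc n} (g , v) (a ∷ d) (β ∷ b) with fredholm g d v
... | inj₁ (y , My) = inRange (fredholm g d b)
  where
  inRange : Solvable g d b ⊎ Obstructed g d b →
    Solvable (g , v) (a ∷ d) (β ∷ b) ⊎ Obstructed (g , v) (a ∷ d) (β ∷ b)
  -- The kernel vector `z` is orthogonal to `v`, which lies in the range, so it stays in the kernel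
  -- after bordering.
  inRange (inj₂ (z , Mz , zb)) = inj₂ (false ∷ z ,
    trans (mul-false∷ g v a d z)
      (cong₂ _∷_ (trans (∙-solved g d My z) (trans (cong (y ∙_) Mz) (∙-zeroʳ y))) Mz) , zb)
  -- The bordered matrix sends `true ∷ y` to the Schur complement `(v ∙ y) xor a` in the first
  -- coordinate and zero elsewhere. If this is `true`, adding `true ∷ y` repairs a wrong first
  -- coordinate of `false ∷ x`; if it is `false`, `true ∷ y` is a kernel vector and obstructs.
  inRange (inj₁ (x , Mx)) = split ((v ∙ x) xor β) ((v ∙ y) xor a) refl refl
    where
    xor-eq : ∀ p q → p xor q ≡ false → p ≡ q
    xor-eq false false _ = refl
    xor-eq true true _ = refl
    split : ∀ p q → (v ∙ x) xor β ≡ p → (v ∙ y) xor a ≡ q →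
      Solvable (g , v) (a ∷ d) (β ∷ b) ⊎ Obstructed (g , v) (a ∷ d) (β ∷ b)
    split false _ p _ = inj₁ (false ∷ x , trans (mul-false∷ g v a d x) (cong₂ _∷_ (xor-eq _ _ p) Mx))
    split true true p q = inj₁ (true ∷ (x ⊕ y) , trans (mul-true∷ g v a d (x ⊕ y)) (cong₂ _∷_ hd tl))
      where
      arrange : ∀ s t a β → s xor β ≡ true → t xor a ≡ true → a xor (s xor t) ≡ β
      arrange false false true  true  _ _ = refl
      arrange false true  false true  _ _ = refl
      arrange true  false true  false _ _ = refl
      arrange true  true  false false _ _ = refl
      hd : a xor (v ∙ (x ⊕ y)) ≡ β
      hd rewrite ∙-distribˡ-⊕ v x y = arrange (v ∙ x) (v ∙ y) a β p q
      tl : v ⊕ mul g d (x ⊕ y) ≡ b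
      tl rewrite mul-⊕ g d x y | Mx | My | ⊕-comm b v = ⊕-cancelˡ v b
    split true false p q = inj₂ (true ∷ y ,
      trans (mul-true∷ g v a d y) (cong₂ _∷_ hd (trans (cong (v ⊕_) My) (⊕-self v))) , dot)
      where
      hd : a xor (v ∙ y) ≡ false
      hd = trans (xor-comm a (v ∙ y)) q
      dot : β xor (y ∙ b) ≡ true
      dot = trans (cong (β xor_) (trans (cong (y ∙_) (sym Mx)) (sym (∙-solved g d My x))))
              (trans (xor-comm β (v ∙ x)) p)
... | inj₂ o = offRange (fredholm g d b) (fredholm g d (v ⊕ b))
  where
  Goal = Solvable (g , v) (a ∷ d) (β ∷ b) ⊎ Obstructed (g , v) (a ∷ d) (β ∷ b)
  obstruct : ∀ w → mul g d w ≡ 𝟘 → v ∙ w ≡ false → w ∙ b ≡ true → Goal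
  obstruct w Mw vw wb = inj₂ (false ∷ w , trans (mul-false∷ g v a d w) (cong₂ _∷_ vw Mw) , wb)
  offRange : Solvable g d b ⊎ Obstructed g d b →
    Solvable g d (v ⊕ b) ⊎ Obstructed g d (v ⊕ b) → Goal
  offRange (inj₁ (x , Mx)) _ with shift-dot g d v o x β
  ... | x′ , Mx′ , vx′ =
    inj₁ (false ∷ x′ , trans (mul-false∷ g v a d x′) (cong₂ _∷_ vx′ (trans Mx′ Mx)))
  offRange (inj₂ _) (inj₁ (x , Mx)) with shift-dot g d v o x (a xor β)
  ... | x′ , Mx′ , vx′ = inj₁ (true ∷ x′ , trans (mul-true∷ g v a d x′) (cong₂ _∷_
    (trans (cong (a xor_) vx′) (trans (sym (xor-assoc a a β)) (cong (_xor β) (xor-same a))))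
    (trans (cong (v ⊕_) (trans Mx′ Mx)) (⊕-cancelˡ v b))))
  -- `w` obstructs `b` and `w′` obstructs `v ⊕ b`. One of `w`, `w′`, `w ⊕ w′` is orthogonal to `v`
  -- and still pairs to `true` with `b`.
  offRange (inj₂ (w , Mw , wb)) (inj₂ (w′ , Mw′ , w′vb)) = combine (v ∙ w) (v ∙ w′) refl refl
    where
    w′v-w′b : (v ∙ w′) xor (w′ ∙ b) ≡ true
    w′v-w′b = trans (cong (_xor (w′ ∙ b)) (∙-comm v w′)) (trans (sym (∙-distribˡ-⊕ w′ v b)) w′vb)
    combine : ∀ p q → v ∙ w ≡ p → v ∙ w′ ≡ q → Goal
    combine false _ p _ = obstruct w Mw p wb
    combine true false _ q = obstruct w′ Mw′ q (trans (cong (_xor (w′ ∙ b)) (sym q)) w′v-w′b)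
    combine true true p q = obstruct (w ⊕ w′)
      (trans (mul-adjust g d w w′ Mw′) Mw)
      (trans (∙-distribˡ-⊕ v w w′) (cong₂ _xor_ p q))
      (trans (∙-comm (w ⊕ w′) b) (trans (∙-distribˡ-⊕ b w w′)
        (cong₂ _xor_ (trans (∙-comm b w) wb) (trans (∙-comm b w′) w′b))))
      where
      neg : ∀ u → true xor u ≡ true → u ≡ false
      neg false _ = refl
      w′b : w′ ∙ b ≡ false
      w′b = neg _ (trans (cong (_xor (w′ ∙ b)) (sym q)) w′v-w′b)

solvable? : ∀ {n} (g : Graph n) (d b : Vec Bool n) → Dec (Solvable g d b)
solvable? g d b with fredholm g d b
... | inj₁ s = yes s
... | inj₂ o = no (¬solvable∧obstructed g d b o)

diagonal-solvable : ∀ {n} (g : Graph n) (d : Vec Bool n) → Solvable g d d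
diagonal-solvable g d with fredholm g d d
... | inj₁ s = s
... | inj₂ (z , Mz , zd)
  with () ← trans (sym zd) (trans (sym (mul-quadratic g d z)) (trans (cong (z ∙_) Mz) (∙-zeroʳ z)))

-- Counting symmetric matrices by nullity

⟦_⟧ : ∀ {p} {P : Set p} → Dec P → ℕ
⟦ yes _ ⟧ = 1
⟦ no _ ⟧ = 0

⟦⟧-cong : ∀ {p q} {P : Set p} {Q : Set q} (P? : Dec P) (Q? : Dec Q) → (P → Q) → (Q → P) → ⟦ P? ⟧ ≡ ⟦ Q? ⟧
⟦⟧-cong (yes _) (yes _) _ _ = refl
⟦⟧-cong (no _) (no _) _ _ = refl
⟦⟧-cong (yes p) (no ¬q) f _ = contradiction (f p) ¬q
⟦⟧-cong (no ¬p) (yes q) _ g = contradiction (g q) ¬p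

⟦⟧-yes : ∀ {p} {P : Set p} (P? : Dec P) → P → ⟦ P? ⟧ ≡ 1
⟦⟧-yes (yes _) _ = refl
⟦⟧-yes (no ¬p) p = contradiction p ¬p

⟦⟧-no : ∀ {p} {P : Set p} (P? : Dec P) → ¬ P → ⟦ P? ⟧ ≡ 0
⟦⟧-no (yes p) ¬p = contradiction p ¬p
⟦⟧-no (no _) _ = refl

⟦⟧-¬ : ∀ {p} {P : Set p} (P? : Dec P) → ⟦ P? ⟧ + ⟦ ¬? P? ⟧ ≡ 1
⟦⟧-¬ (yes _) = refl
⟦⟧-¬ (no _) = refl

-- Lets a range size be replaced by its value on the matrices of one nullity, where the indicator
-- selects them.
⟦⟧-weight : ∀ {p} {P : Set p} (P? : Dec P) {a b : ℕ} → (P → a ≡ b) → a * ⟦ P? ⟧ ≡ b * ⟦ P? ⟧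
⟦⟧-weight (yes p) f = cong (_* 1) (f p)
⟦⟧-weight (no _) {a} {b} _ = trans (*-zeroʳ a) (sym (*-zeroʳ b))

-- Sums over lists, vectors and graphs

∑ : ∀ {a} {A : Set a} → List A → (A → ℕ) → ℕ
∑ [] f = 0
∑ (x ∷ xs) f = f x + ∑ xs f

module _ {a} {A : Set a} where

  ∑-cong : (xs : List A) {f g : A → ℕ} → (∀ x → f x ≡ g x) → ∑ xs f ≡ ∑ xs g
  ∑-cong [] _ = refl
  ∑-cong (x ∷ xs) eq = cong₂ _+_ (eq x) (∑-cong xs eq)

  ∑-+ : (xs : List A) (f g : A → ℕ) → ∑ xs (λ x → f x + g x) ≡ ∑ xs f + ∑ xs g
  ∑-+ [] f g = refl
  ∑-+ (x ∷ xs) f g rewrite ∑-+ xs f g =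
    solve 4 (λ a b c d → (a :+ b) :+ (c :+ d) := (a :+ c) :+ (b :+ d)) refl (f x) (g x) (∑ xs f) (∑ xs g)
    where open +-*-Solver using (solve; _:+_; _:*_; _:=_; con)

  ∑-*ˡ : (xs : List A) (c : ℕ) (f : A → ℕ) → ∑ xs (λ x → c * f x) ≡ c * ∑ xs f
  ∑-*ˡ [] c f = sym (*-zeroʳ c)
  ∑-*ˡ (x ∷ xs) c f rewrite ∑-*ˡ xs c f = sym (*-distribˡ-+ c (f x) (∑ xs f))

  ∑-*ʳ : (xs : List A) (f : A → ℕ) (c : ℕ) → ∑ xs (λ x → f x * c) ≡ ∑ xs f * c
  ∑-*ʳ xs f c = trans (∑-cong xs (λ x → *-comm (f x) c)) (trans (∑-*ˡ xs c f) (*-comm c _))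

  ∑-zero : (xs : List A) {f : A → ℕ} → (∀ x → f x ≡ 0) → ∑ xs f ≡ 0
  ∑-zero [] _ = refl
  ∑-zero (x ∷ xs) eq = cong₂ _+_ (eq x) (∑-zero xs eq)

  ∑-++ : (xs ys : List A) (f : A → ℕ) → ∑ (xs ++ ys) f ≡ ∑ xs f + ∑ ys f
  ∑-++ [] ys f = refl
  ∑-++ (x ∷ xs) ys f = trans (cong (f x +_) (∑-++ xs ys f)) (sym (+-assoc (f x) _ _))

  length-filter≡∑ : ∀ {p} {P : Pred A p} (P? : Decidable P) (xs : List A) →
    length (filter P? xs) ≡ ∑ xs (λ x → ⟦ P? x ⟧)
  length-filter≡∑ P? [] = refl
  length-filter≡∑ P? (x ∷ xs) with P? x
  ... | yes _ = cong suc (length-filter≡∑ P? xs)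
  ... | no _ = length-filter≡∑ P? xs

module _ {a b} {A : Set a} {B : Set b} where

  ∑-map : (h : A → B) (xs : List A) (f : B → ℕ) → ∑ (List.map h xs) f ≡ ∑ xs (λ x → f (h x))
  ∑-map h [] f = refl
  ∑-map h (x ∷ xs) f = cong (f (h x) +_) (∑-map h xs f)

  ∑-concatMap : (h : A → List B) (xs : List A) (f : B → ℕ) →
    ∑ (concatMap h xs) f ≡ ∑ xs (λ x → ∑ (h x) f)
  ∑-concatMap h [] f = refl
  ∑-concatMap h (x ∷ xs) f = trans (∑-++ (h x) _ f) (cong (∑ (h x) f +_) (∑-concatMap h xs f))

  ∑-swap : (xs : List A) (ys : List B) (f : A → B → ℕ) →
    ∑ xs (λ x → ∑ ys (f x)) ≡ ∑ ys (λ y → ∑ xs (λ x → f x y))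
  ∑-swap [] ys f = sym (∑-zero ys (λ _ → refl))
  ∑-swap (x ∷ xs) ys f = trans (cong (∑ ys (f x) +_) (∑-swap xs ys f)) (sym (∑-+ ys (f x) _))

∑-allVecs-suc : ∀ n (f : Vec Bool (suc n) → ℕ) →
  ∑ (allVecs (suc n)) f ≡ ∑ (allVecs n) (λ v → f (false ∷ v) + f (true ∷ v))
∑-allVecs-suc n f = trans (∑-concatMap _ (allVecs n) f)
  (∑-cong (allVecs n) (λ v → cong (f (false ∷ v) +_) (+-identityʳ _)))

∑-allGraphs-suc : ∀ n (f : Graph (suc n) → ℕ) →
  ∑ (allGraphs (suc n)) f ≡ ∑ (allGraphs n) (λ g → ∑ (allVecs n) (λ v → f (g , v)))
∑-allGraphs-suc n f = trans (∑-concatMap _ (allGraphs n) f)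
  (∑-cong (allGraphs n) (λ g → ∑-map (g ,_) (allVecs n) f))

-- Translation permutes the vectors. This gives the equal size of nonempty fibres, the halving in
-- `extend-obstructed` and the uniformity of the reduced Laplacian.
∑-shift : ∀ n (c : Vec Bool n) (f : Vec Bool n → ℕ) →
  ∑ (allVecs n) (λ x → f (x ⊕ c)) ≡ ∑ (allVecs n) f
∑-shift zero [] f = refl
∑-shift (suc n) (a ∷ c) f = begin
  ∑ (allVecs (suc n)) (λ x → f (x ⊕ (a ∷ c)))                    ≡⟨ ∑-allVecs-suc n _ ⟩
  ∑ (allVecs n) (λ x → f (a ∷ (x ⊕ c)) + f (not a ∷ (x ⊕ c)))    ≡⟨ ∑-shift n c (λ x → f (a ∷ x) + f (not a ∷ x)) ⟩
  ∑ (allVecs n) (λ x → f (a ∷ x) + f (not a ∷ x))                ≡⟨ ∑-cong (allVecs n) (unordered a) ⟩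
  ∑ (allVecs n) (λ x → f (false ∷ x) + f (true ∷ x))             ≡⟨ ∑-allVecs-suc n f ⟨
  ∑ (allVecs (suc n)) f                                          ∎
  where
  unordered : ∀ a x → f (a ∷ x) + f (not a ∷ x) ≡ f (false ∷ x) + f (true ∷ x)
  unordered false x = refl
  unordered true x = +-comm (f (true ∷ x)) _

∑-one : ∀ n → ∑ (allVecs n) (λ _ → 1) ≡ 2 ^ n
∑-one zero = refl
∑-one (suc n) = trans (∑-allVecs-suc n (λ _ → 1)) (trans (∑-*ˡ (allVecs n) 2 (λ _ → 1)) (cong (2 *_) (∑-one n)))

infix 4 _≟ᵛ_

_≟ᵛ_ : ∀ {n} (x y : Vec Bool n) → Dec (x ≡ y)
_≟ᵛ_ = ≡-dec Data.Bool._≟_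

∑-point : ∀ n (w : Vec Bool n) → ∑ (allVecs n) (λ b → ⟦ w ≟ᵛ b ⟧) ≡ 1
∑-point zero [] = refl
∑-point (suc n) (a ∷ w) = begin
  ∑ (allVecs (suc n)) (λ b → ⟦ a ∷ w ≟ᵛ b ⟧)                                   ≡⟨ ∑-allVecs-suc n _ ⟩
  ∑ (allVecs n) (λ b → ⟦ a ∷ w ≟ᵛ false ∷ b ⟧ + ⟦ a ∷ w ≟ᵛ true ∷ b ⟧)         ≡⟨ ∑-cong (allVecs n) (pick a) ⟩
  ∑ (allVecs n) (λ b → ⟦ w ≟ᵛ b ⟧)                                             ≡⟨ ∑-point n w ⟩
  1                                                                            ∎
  where
  same : ∀ a b → ⟦ a ∷ w ≟ᵛ a ∷ b ⟧ ≡ ⟦ w ≟ᵛ b ⟧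
  same a b = ⟦⟧-cong (a ∷ w ≟ᵛ a ∷ b) (w ≟ᵛ b) (λ e → proj₂ (∷-injective e)) (cong (a ∷_))
  pick : ∀ a b → ⟦ a ∷ w ≟ᵛ false ∷ b ⟧ + ⟦ a ∷ w ≟ᵛ true ∷ b ⟧ ≡ ⟦ w ≟ᵛ b ⟧
  pick false b = trans (cong₂ _+_ (same false b) (⟦⟧-no (false ∷ w ≟ᵛ true ∷ b) λ ())) (+-identityʳ _)
  pick true b = cong₂ _+_ (⟦⟧-no (true ∷ w ≟ᵛ false ∷ b) λ ()) (same true b)

-- Solution counts and the size of the range

solutions : ∀ {n} → Graph n → Vec Bool n → Vec Bool n → ℕ
solutions {n} g d b = ∑ (allVecs n) (λ x → ⟦ mul g d x ≟ᵛ b ⟧)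

diagonalSolutions : ∀ {n} → Graph n → Vec Bool n → ℕ
diagonalSolutions g d = solutions g d d

range : ∀ {n} → Graph n → Vec Bool n → ℕ
range {n} g d = ∑ (allVecs n) (λ b → ⟦ solvable? g d b ⟧)

-- The number of vectors outside the range, not the dimension of a cokernel.
corange : ∀ {n} → Graph n → Vec Bool n → ℕ
corange {n} g d = ∑ (allVecs n) (λ b → ⟦ ¬? (solvable? g d b) ⟧)

range+corange : ∀ {n} (g : Graph n) (d : Vec Bool n) → range g d + corange g d ≡ 2 ^ n
range+corange {n} g d = trans (sym (∑-+ (allVecs n) _ _))
  (trans (∑-cong (allVecs n) (λ b → ⟦⟧-¬ (solvable? g d b))) (∑-one n))

solutions-homogeneous : ∀ {n} (g : Graph n) (d : Vec Bool n) {b : Vec Bool n} →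
  Solvable g d b → solutions g d b ≡ solutions g d 𝟘
solutions-homogeneous {n} g d {b} (y , My) = begin
  ∑ (allVecs n) (λ x → ⟦ mul g d x ≟ᵛ b ⟧)        ≡⟨ ∑-shift n y _ ⟨
  ∑ (allVecs n) (λ x → ⟦ mul g d (x ⊕ y) ≟ᵛ b ⟧)  ≡⟨ ∑-cong (allVecs n) (λ x → ⟦⟧-cong (mul g d (x ⊕ y) ≟ᵛ b) (mul g d x ≟ᵛ 𝟘) (to x) (from x)) ⟩
  ∑ (allVecs n) (λ x → ⟦ mul g d x ≟ᵛ 𝟘 ⟧)        ∎
  where
  expand : ∀ x → mul g d (x ⊕ y) ≡ mul g d x ⊕ b
  expand x = trans (mul-⊕ g d x y) (cong (mul g d x ⊕_) My)
  to : ∀ x → mul g d (x ⊕ y) ≡ b → mul g d x ≡ 𝟘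
  to x e = trans (sym (⊕-cancelʳ (mul g d x) b))
    (trans (cong (_⊕ b) (trans (sym (expand x)) e)) (⊕-self b))
  from : ∀ x → mul g d x ≡ 𝟘 → mul g d (x ⊕ y) ≡ b
  from x e = trans (expand x) (trans (cong (_⊕ b) e) (⊕-identityˡ b))

solutions-unsolvable : ∀ {n} (g : Graph n) (d : Vec Bool n) {b : Vec Bool n} →
  ¬ Solvable g d b → solutions g d b ≡ 0
solutions-unsolvable {n} g d {b} ¬s = ∑-zero (allVecs n) (λ x → ⟦⟧-no (mul g d x ≟ᵛ b) (λ e → ¬s (x , e)))

-- Nonempty fibres are cosets of the kernel. The fibre over `d` is never empty, so
-- `diagonalSolutions` is the size of the kernel and serves as the common fibre size.
solutions-uniform : ∀ {n} (g : Graph n) (d b : Vec Bool n) →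
  solutions g d b ≡ ⟦ solvable? g d b ⟧ * diagonalSolutions g d
solutions-uniform g d b with solvable? g d b
... | yes s = trans (trans (solutions-homogeneous g d s) (sym (solutions-homogeneous g d (diagonal-solvable g d))))
                (sym (*-identityˡ _))
... | no ¬s = solutions-unsolvable g d ¬s

-- Rank-nullity in cardinalities, by double counting the pairs of a vector and its image.
range*solutions : ∀ {n} (g : Graph n) (d : Vec Bool n) → range g d * diagonalSolutions g d ≡ 2 ^ n
range*solutions {n} g d = begin
  range g d * diagonalSolutions g d                                      ≡⟨ ∑-*ʳ (allVecs n) _ (diagonalSolutions g d) ⟨
  ∑ (allVecs n) (λ b → ⟦ solvable? g d b ⟧ * diagonalSolutions g d)      ≡⟨ ∑-cong (allVecs n) (λ b → sym (solutions-uniform g d b)) ⟩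
  ∑ (allVecs n) (λ b → solutions g d b)                                  ≡⟨ ∑-swap (allVecs n) (allVecs n) _ ⟩
  ∑ (allVecs n) (λ x → ∑ (allVecs n) (λ b → ⟦ mul g d x ≟ᵛ b ⟧))         ≡⟨ ∑-cong (allVecs n) (λ x → ∑-point n (mul g d x)) ⟩
  ∑ (allVecs n) (λ _ → 1)                                                ≡⟨ ∑-one n ⟩
  2 ^ n                                                                  ∎

-- Bordering a symmetric matrix by one row and column

module _ {n} (g : Graph n) (d v : Vec Bool n) where

  private
    diag-suc : ∀ a → diagonalSolutions (g , v) (a ∷ d) ≡
      ∑ (allVecs n) (λ x → ⟦ mul (g , v) (a ∷ d) (false ∷ x) ≟ᵛ a ∷ d ⟧)
      + ∑ (allVecs n) (λ x → ⟦ mul (g , v) (a ∷ d) (true ∷ x) ≟ᵛ a ∷ d ⟧)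
    diag-suc a = trans (∑-allVecs-suc n _) (∑-+ (allVecs n) _ _)

  -- Solutions are split by their first coordinate. If it is `false`, `v ∙ x` equals `v ∙ y` for
  -- every solution `x` of the smaller system, so the corner `a` admits all of them or none. If it
  -- is `true`, translation by `y` cancels the column and the first equation then holds by itself.
  extend-solvable : ∀ {y} → mul g d y ≡ v → ∀ a → diagonalSolutions (g , v) (a ∷ d) ≡
    ⟦ v ∙ y Data.Bool.≟ a ⟧ * diagonalSolutions g d + diagonalSolutions g d
  extend-solvable {y} My a = trans (diag-suc a) (cong₂ _+_ without with′)
    where
    vx : ∀ x → mul g d x ≡ d → v ∙ x ≡ v ∙ y
    vx x Mx = begin
      v ∙ x          ≡⟨ ∙-solved g d My x ⟩
      y ∙ mul g d x  ≡⟨ cong (y ∙_) Mx ⟩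
      y ∙ d          ≡⟨ mul-quadratic g d y ⟨
      y ∙ mul g d y  ≡⟨ ∙-solved g d My y ⟨
      v ∙ y          ∎
    split : ∀ x → ⟦ mul (g , v) (a ∷ d) (false ∷ x) ≟ᵛ a ∷ d ⟧ ≡ ⟦ v ∙ y Data.Bool.≟ a ⟧ * ⟦ mul g d x ≟ᵛ d ⟧
    split x with v ∙ y Data.Bool.≟ a
    ... | yes e = trans (⟦⟧-cong (_ ≟ᵛ a ∷ d) (mul g d x ≟ᵛ d)
                    (λ h → proj₂ (∷-injective (trans (sym (mul-false∷ g v a d x)) h)))
                    (λ Mx → trans (mul-false∷ g v a d x) (cong₂ _∷_ (trans (vx x Mx) e) Mx)))
                  (sym (*-identityˡ _))
    ... | no ¬e = ⟦⟧-no (_ ≟ᵛ a ∷ d) λ h →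
                    let hd , Mx = ∷-injective (trans (sym (mul-false∷ g v a d x)) h)
                    in ¬e (trans (sym (vx x Mx)) hd)
    without : ∑ (allVecs n) (λ x → ⟦ mul (g , v) (a ∷ d) (false ∷ x) ≟ᵛ a ∷ d ⟧)
            ≡ ⟦ v ∙ y Data.Bool.≟ a ⟧ * diagonalSolutions g d
    without = trans (∑-cong (allVecs n) split) (∑-*ˡ (allVecs n) ⟦ v ∙ y Data.Bool.≟ a ⟧ _)
    shifted : ∀ x → v ⊕ mul g d (x ⊕ y) ≡ mul g d x
    shifted x rewrite mul-⊕ g d x y | My | ⊕-comm (mul g d x) v = ⊕-cancelˡ v _
    with′ : ∑ (allVecs n) (λ x → ⟦ mul (g , v) (a ∷ d) (true ∷ x) ≟ᵛ a ∷ d ⟧) ≡ diagonalSolutions g d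
    with′ = trans (sym (∑-shift n y _)) (∑-cong (allVecs n) λ x → ⟦⟧-cong (_ ≟ᵛ a ∷ d) (mul g d x ≟ᵛ d)
      (λ h → trans (sym (shifted x)) (proj₂ (∷-injective (trans (sym (mul-true∷ g v a d (x ⊕ y))) h))))
      (λ Mx → trans (mul-true∷ g v a d (x ⊕ y)) (cong₂ _∷_ (hd x Mx) (trans (shifted x) Mx))))
      where
      hd : ∀ x → mul g d x ≡ d → a xor (v ∙ (x ⊕ y)) ≡ a
      hd x Mx rewrite ∙-distribˡ-⊕ v x y | vx x Mx | xor-same (v ∙ y) = xor-identityʳ a

  -- A solution with first coordinate `true` would put `v` in the range, because `d` is there
  -- already. With first coordinate `false`, the first equation selects exactly one of `x` and
  -- `x ⊕ z`. Doubling the left side states the halving without division.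
  extend-obstructed : Obstructed g d v → ∀ a →
    diagonalSolutions (g , v) (a ∷ d) + diagonalSolutions (g , v) (a ∷ d) ≡ diagonalSolutions g d
  extend-obstructed o@(z , Mz , zv) a = begin
    S′ + S′                                          ≡⟨ cong₂ _+_ S′≡ (trans S′≡ (sym (∑-shift n z _))) ⟩
    ∑ (allVecs n) f + ∑ (allVecs n) (λ x → f (x ⊕ z)) ≡⟨ ∑-+ (allVecs n) _ _ ⟨
    ∑ (allVecs n) (λ x → f x + f (x ⊕ z))            ≡⟨ ∑-cong (allVecs n) halves ⟩
    diagonalSolutions g d                            ∎
    where
    S′ = diagonalSolutions (g , v) (a ∷ d)
    f : Vec Bool n → ℕ
    f x = ⟦ mul (g , v) (a ∷ d) (false ∷ x) ≟ᵛ a ∷ d ⟧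
    no-true : ∀ x → mul (g , v) (a ∷ d) (true ∷ x) ≢ a ∷ d
    no-true x h with w , Mw ← diagonal-solvable g d =
      ¬solvable∧obstructed g d v o (x ⊕ w , trans (mul-⊕ g d x w) (trans (cong (mul g d x ⊕_) Mw) (
        trans (⊕-comm (mul g d x) d) (trans (cong (_⊕ mul g d x) (sym vMx)) (⊕-cancelʳ v _)))))
      where vMx = proj₂ (∷-injective (trans (sym (mul-true∷ g v a d x)) h))
    S′≡ : S′ ≡ ∑ (allVecs n) f
    S′≡ = trans (diag-suc a) (trans (cong (∑ (allVecs n) f +_)
      (∑-zero (allVecs n) (λ x → ⟦⟧-no (_ ≟ᵛ a ∷ d) (no-true x)))) (+-identityʳ _))
    components : ∀ x → mul (g , v) (a ∷ d) (false ∷ x) ≡ a ∷ d → v ∙ x ≡ a × mul g d x ≡ d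
    components x h = ∷-injective (trans (sym (mul-false∷ g v a d x)) h)
    halves : ∀ x → f x + f (x ⊕ z) ≡ ⟦ mul g d x ≟ᵛ d ⟧
    halves x with mul g d x ≟ᵛ d | v ∙ x Data.Bool.≟ a
    ... | no ¬e | _ = cong₂ _+_
      (⟦⟧-no (_ ≟ᵛ a ∷ d) (λ h → ¬e (proj₂ (components x h))))
      (⟦⟧-no (_ ≟ᵛ a ∷ d) (λ h → ¬e (trans (sym (mul-adjust g d x z Mz)) (proj₂ (components (x ⊕ z) h)))))
    ... | yes e | yes vx = cong₂ _+_
      (⟦⟧-yes (_ ≟ᵛ a ∷ d) (trans (mul-false∷ g v a d x) (cong₂ _∷_ vx e)))
      (⟦⟧-no (_ ≟ᵛ a ∷ d) (λ h → not-¬ {v ∙ x} refl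
        (trans vx (trans (sym (proj₁ (components (x ⊕ z) h))) (∙-adjust v x z zv)))))
    ... | yes e | no ¬vx = cong₂ _+_
      (⟦⟧-no (_ ≟ᵛ a ∷ d) (λ h → ¬vx (proj₁ (components x h))))
      (⟦⟧-yes (_ ≟ᵛ a ∷ d) (trans (mul-false∷ g v a d (x ⊕ z))
        (cong₂ _∷_ (trans (∙-adjust v x z zv) (sym (¬-not (λ e′ → ¬vx (sym e′))))) (trans (mul-adjust g d x z Mz) e))))

double-injective : ∀ {m n} → m + m ≡ n + n → m ≡ n
double-injective {m} {n} e = trans (n≡⌊n+n/2⌋ m) (trans (cong ⌊_/2⌋ e) (sym (n≡⌊n+n/2⌋ n)))

-- Indicators replace the case distinction so that summing over `v` yields `range` and `corange`.
-- The factor 2 appears because both corner values lower the nullity.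
extensions : ∀ {n} (g : Graph n) (d v : Vec Bool n) (q : ℕ) → let S = diagonalSolutions g d in
  ⟦ diagonalSolutions (g , v) (false ∷ d) ≟ q ⟧ + ⟦ diagonalSolutions (g , v) (true ∷ d) ≟ q ⟧
  ≡ ⟦ solvable? g d v ⟧ * (⟦ S + S ≟ q ⟧ + ⟦ S ≟ q ⟧) + ⟦ ¬? (solvable? g d v) ⟧ * (2 * ⟦ S ≟ q + q ⟧)
extensions g d v q with fredholm g d v
... | inj₁ (y , My) rewrite extend-solvable g d v My false | extend-solvable g d v My true
      | *-identityˡ (⟦ diagonalSolutions g d + diagonalSolutions g d ≟ q ⟧ + ⟦ diagonalSolutions g d ≟ q ⟧)
      | +-identityʳ (⟦ diagonalSolutions g d + diagonalSolutions g d ≟ q ⟧ + ⟦ diagonalSolutions g d ≟ q ⟧)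
  = go (v ∙ y)
  where
  S = diagonalSolutions g d
  go : ∀ e → ⟦ ⟦ e Data.Bool.≟ false ⟧ * S + S ≟ q ⟧ + ⟦ ⟦ e Data.Bool.≟ true ⟧ * S + S ≟ q ⟧ ≡ ⟦ S + S ≟ q ⟧ + ⟦ S ≟ q ⟧
  go false rewrite +-identityʳ S = refl
  go true rewrite +-identityʳ S = +-comm ⟦ S ≟ q ⟧ _
... | inj₂ o = trans (cong₂ _+_ (half false) (trans (half true) (sym (+-identityʳ _)))) (sym (+-identityʳ _))
  where
  half : ∀ a → ⟦ diagonalSolutions (g , v) (a ∷ d) ≟ q ⟧ ≡ ⟦ diagonalSolutions g d ≟ q + q ⟧
  half a = ⟦⟧-cong (_ ≟ q) (_ ≟ q + q)
    (λ e → trans (sym (extend-obstructed g d v o a)) (cong₂ _+_ e e))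
    (λ e → double-injective (trans (extend-obstructed g d v o a) e))

-- Recursion for the number of matrices of given nullity

∑ₘ : ∀ n → (Graph n → Vec Bool n → ℕ) → ℕ
∑ₘ n f = ∑ (allGraphs n) (λ g → ∑ (allVecs n) (f g))

∑ₘ-cong : ∀ n {f h : Graph n → Vec Bool n → ℕ} → (∀ g d → f g d ≡ h g d) → ∑ₘ n f ≡ ∑ₘ n h
∑ₘ-cong n eq = ∑-cong (allGraphs n) (λ g → ∑-cong (allVecs n) (eq g))

∑ₘ-+ : ∀ n (f h : Graph n → Vec Bool n → ℕ) → ∑ₘ n (λ g d → f g d + h g d) ≡ ∑ₘ n f + ∑ₘ n h
∑ₘ-+ n f h = trans (∑-cong (allGraphs n) (λ g → ∑-+ (allVecs n) (f g) (h g))) (∑-+ (allGraphs n) _ _)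

∑ₘ-*ˡ : ∀ n c (f : Graph n → Vec Bool n → ℕ) → ∑ₘ n (λ g d → c * f g d) ≡ c * ∑ₘ n f
∑ₘ-*ˡ n c f = trans (∑-cong (allGraphs n) (λ g → ∑-*ˡ (allVecs n) c (f g))) (∑-*ˡ (allGraphs n) c _)

∑ₘ-zero : ∀ n {f : Graph n → Vec Bool n → ℕ} → (∀ g d → f g d ≡ 0) → ∑ₘ n f ≡ 0
∑ₘ-zero n eq = ∑-zero (allGraphs n) (λ g → ∑-zero (allVecs n) (eq g))

-- The number of symmetric n × n matrices M over 𝔽₂ such that M x = diag M has q solutions;
-- for q = 2 ^ k these are the matrices of nullity k.
matrices : ℕ → ℕ → ℕ
matrices n q = ∑ₘ n (λ g d → ⟦ diagonalSolutions g d ≟ q ⟧)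

nullity-up : ℕ → ℕ → ℕ
nullity-up n q = ∑ₘ n (λ g d → range g d * ⟦ diagonalSolutions g d + diagonalSolutions g d ≟ q ⟧)

nullity-same : ℕ → ℕ → ℕ
nullity-same n q = ∑ₘ n (λ g d → range g d * ⟦ diagonalSolutions g d ≟ q ⟧)

nullity-down : ℕ → ℕ → ℕ
nullity-down n q = ∑ₘ n (λ g d → corange g d * ⟦ diagonalSolutions g d ≟ q + q ⟧)

matrices-suc : ∀ n q → matrices (suc n) q ≡ nullity-up n q + nullity-same n q + 2 * nullity-down n q
matrices-suc n q = begin
  matrices (suc n) q
    ≡⟨ ∑-allGraphs-suc n _ ⟩
  ∑ (allGraphs n) (λ g → ∑ (allVecs n) λ v → ∑ (allVecs (suc n)) λ d → ⟦ diagonalSolutions (g , v) d ≟ q ⟧)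
    ≡⟨ ∑-cong (allGraphs n) (λ g → trans (∑-cong (allVecs n) (λ v → ∑-allVecs-suc n _)) (∑-swap (allVecs n) (allVecs n) _)) ⟩
  ∑ₘ n (λ g d → ∑ (allVecs n) λ v →
    ⟦ diagonalSolutions (g , v) (false ∷ d) ≟ q ⟧ + ⟦ diagonalSolutions (g , v) (true ∷ d) ≟ q ⟧)
    ≡⟨ ∑ₘ-cong n count ⟩
  ∑ₘ n (λ g d → up g d + same g d + 2 * down g d)
    ≡⟨ ∑ₘ-+ n (λ g d → up g d + same g d) (λ g d → 2 * down g d) ⟩
  ∑ₘ n (λ g d → up g d + same g d) + ∑ₘ n (λ g d → 2 * down g d)
    ≡⟨ cong₂ _+_ (∑ₘ-+ n up same) (∑ₘ-*ˡ n 2 down) ⟩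
  nullity-up n q + nullity-same n q + 2 * nullity-down n q ∎
  where
  up same down : Graph n → Vec Bool n → ℕ
  up g d = range g d * ⟦ diagonalSolutions g d + diagonalSolutions g d ≟ q ⟧
  same g d = range g d * ⟦ diagonalSolutions g d ≟ q ⟧
  down g d = corange g d * ⟦ diagonalSolutions g d ≟ q + q ⟧
  count : ∀ g d → ∑ (allVecs n) (λ v →
    ⟦ diagonalSolutions (g , v) (false ∷ d) ≟ q ⟧ + ⟦ diagonalSolutions (g , v) (true ∷ d) ≟ q ⟧)
    ≡ up g d + same g d + 2 * down g d
  count g d = begin
    _ ≡⟨ ∑-cong (allVecs n) (λ v → extensions g d v q) ⟩
    _ ≡⟨ ∑-+ (allVecs n) _ _ ⟩
    _ ≡⟨ cong₂ _+_ (∑-*ʳ (allVecs n) _ (A + B)) (∑-*ʳ (allVecs n) _ (2 * C)) ⟩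
    range g d * (A + B) + corange g d * (2 * C)
      ≡⟨ solve 5 (λ r A B c C → r :* (A :+ B) :+ c :* (con 2 :* C) := r :* A :+ r :* B :+ con 2 :* (c :* C))
           refl (range g d) A B (corange g d) C ⟩
    up g d + same g d + 2 * down g d ∎
    where
    open +-*-Solver using (solve; _:+_; _:*_; _:=_; con)
    A = ⟦ diagonalSolutions g d + diagonalSolutions g d ≟ q ⟧
    B = ⟦ diagonalSolutions g d ≟ q ⟧
    C = ⟦ diagonalSolutions g d ≟ q + q ⟧

mersenne : ℕ → ℕ
mersenne i = 2 ^ i ∸ 1

1+mersenne : ∀ i → 1 + mersenne i ≡ 2 ^ i
1+mersenne i = m+[n∸m]≡n (m^n>0 2 i)

-- `j` is the rank; the equation `j + k ≡ n` stands in for a truncated subtraction here and in the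
-- lemmas below.
range-2^ : ∀ {n} (g : Graph n) (d : Vec Bool n) j {k} → j + k ≡ n →
  diagonalSolutions g d ≡ 2 ^ k → range g d ≡ 2 ^ j
range-2^ g d j {k} refl eq = *-cancelʳ-≡ (range g d) (2 ^ j) (2 ^ k) {{m^n≢0 2 k}}
  (trans (cong (range g d *_) (sym eq)) (trans (range*solutions g d) (^-distribˡ-+-* 2 j k)))

corange-2^ : ∀ {n} (g : Graph n) (d : Vec Bool n) j {k} → j + k ≡ n →
  diagonalSolutions g d ≡ 2 ^ k → corange g d ≡ 2 ^ j * mersenne k
corange-2^ {n} g d j {k} j+k eq = +-cancelˡ-≡ (2 ^ j) _ _ (begin
  2 ^ j + corange g d         ≡⟨ cong (_+ corange g d) (range-2^ g d j j+k eq) ⟨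
  range g d + corange g d     ≡⟨ range+corange g d ⟩
  2 ^ n                       ≡⟨ cong (2 ^_) j+k ⟨
  2 ^ (j + k)                 ≡⟨ ^-distribˡ-+-* 2 j k ⟩
  2 ^ j * 2 ^ k               ≡⟨ cong (2 ^ j *_) (1+mersenne k) ⟨
  2 ^ j * (1 + mersenne k)    ≡⟨ *-suc (2 ^ j) (mersenne k) ⟩
  2 ^ j + 2 ^ j * mersenne k  ∎)

-- By `range*solutions` the count divides `2 ^ n`. This settles the boundary of the recursion, where
-- the rank would be negative.
solutions≢large : ∀ {n} (g : Graph n) (d : Vec Bool n) {k} → n < k → diagonalSolutions g d ≢ 2 ^ k
solutions≢large {n} g d {k} n<k eq with range g d in r | range*solutions g d
... | zero  | e = m^n≢0′ (sym e)
  where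
  m^n≢0′ : 2 ^ n ≢ 0
  m^n≢0′ = ≢-nonZero⁻¹ (2 ^ n) {{m^n≢0 2 n}}
... | suc c | e = <-irrefl refl (<-≤-trans (^-monoʳ-< 2 (s≤s (s≤s z≤n)) n<k)
  (≤-trans (m≤m+n (2 ^ k) (c * 2 ^ k)) (≤-reflexive (trans (cong (suc c *_) (sym eq)) e))))

^-suc-double : ∀ k → 2 ^ suc k ≡ 2 ^ k + 2 ^ k
^-suc-double k = cong (2 ^ k +_) (+-identityʳ (2 ^ k))

nullity-up-zero : ∀ n → nullity-up n (2 ^ 0) ≡ 0
nullity-up-zero n = ∑ₘ-zero n λ g d →
  trans (cong (range g d *_) (⟦⟧-no (_ ≟ 1) (odd (diagonalSolutions g d)))) (*-zeroʳ (range g d))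
  where
  odd : ∀ s → s + s ≢ 1
  odd (suc s) e with () ← trans (sym (+-suc s s)) (suc-injective e)

nullity-up-suc : ∀ {n} j k → j + k ≡ n → nullity-up n (2 ^ suc k) ≡ 2 ^ j * matrices n (2 ^ k)
nullity-up-suc {n} j k j+k = trans
  (∑ₘ-cong n λ g d → trans
    (cong (range g d *_) (⟦⟧-cong (_ ≟ 2 ^ suc k) (diagonalSolutions g d ≟ 2 ^ k)
      (λ e → double-injective (trans e (^-suc-double k)))
      (λ e → trans (cong₂ _+_ e e) (sym (^-suc-double k)))))
    (⟦⟧-weight (diagonalSolutions g d ≟ 2 ^ k) (range-2^ g d j j+k)))
  (∑ₘ-*ˡ n (2 ^ j) _)

nullity-same-2^ : ∀ {n} j k → j + k ≡ n → nullity-same n (2 ^ k) ≡ 2 ^ j * matrices n (2 ^ k)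
nullity-same-2^ {n} j k j+k = trans
  (∑ₘ-cong n λ g d → ⟦⟧-weight (diagonalSolutions g d ≟ 2 ^ k) (range-2^ g d j j+k))
  (∑ₘ-*ˡ n (2 ^ j) _)

nullity-same-large : ∀ {n k} → n < k → nullity-same n (2 ^ k) ≡ 0
nullity-same-large {n} {k} n<k = ∑ₘ-zero n λ g d →
  trans (cong (range g d *_) (⟦⟧-no (_ ≟ 2 ^ k) (solutions≢large g d n<k))) (*-zeroʳ (range g d))

nullity-down-2^ : ∀ {n} j k → j + suc k ≡ n →
  nullity-down n (2 ^ k) ≡ 2 ^ j * mersenne (suc k) * matrices n (2 ^ suc k)
nullity-down-2^ {n} j k j+k rewrite sym (^-suc-double k) = trans
  (∑ₘ-cong n λ g d → ⟦⟧-weight (diagonalSolutions g d ≟ 2 ^ suc k) (corange-2^ g d j j+k))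
  (∑ₘ-*ˡ n (2 ^ j * mersenne (suc k)) _)

nullity-down-large : ∀ {n k} → n < suc k → nullity-down n (2 ^ k) ≡ 0
nullity-down-large {n} {k} n<k rewrite sym (^-suc-double k) = ∑ₘ-zero n λ g d →
  trans (cong (corange g d *_) (⟦⟧-no (_ ≟ 2 ^ suc k) (solutions≢large g d n<k))) (*-zeroʳ (corange g d))

-- Even partitions and the reduced Laplacian

odd : ℕ → Bool
odd zero = false
odd (suc n) = not (odd n)

even⇒¬odd : ∀ {n} → 2 ∣ n → odd n ≡ false
even⇒¬odd (divides q refl) = go q
  where
  go : ∀ q → odd (q * 2) ≡ false
  go zero = refl
  go (suc q) = trans (not-involutive _) (go q)

¬odd⇒even : ∀ n → odd n ≡ false → 2 ∣ n
¬odd⇒even zero _ = divides 0 refl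
¬odd⇒even (suc (suc n)) e with divides q eq ← ¬odd⇒even n (trans (sym (not-involutive _)) e) =
  divides (suc q) (cong (2 +_) eq)

xorSum : ∀ n → (Fin n → Bool) → Bool
xorSum zero p = false
xorSum (suc n) p = p zero xor xorSum n (p ∘ suc)

odd-length-filter : ∀ {n} m (p : Fin n → Bool) (h : Fin m → Fin n) →
  odd (length (filter (λ u → p u Data.Bool.≟ true) (tabulate h))) ≡ xorSum m (p ∘ h)
odd-length-filter zero p h = refl
odd-length-filter (suc m) p h with p (h zero)
... | true = cong not (odd-length-filter m p (h ∘ suc))
... | false = odd-length-filter m p (h ∘ suc)

xorSum-lookup : ∀ {n} (v x : Vec Bool n) → xorSum n (λ u → lookup v u ∧ lookup x u) ≡ v ∙ x
xorSum-lookup [] [] = refl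
xorSum-lookup (a ∷ v) (b ∷ x) = cong ((a ∧ b) xor_) (xorSum-lookup v x)

xorSum-adj : ∀ {n} (g : Graph n) (x : Vec Bool n) v →
  xorSum n (λ u → adj g v u ∧ lookup x u) ≡ lookup (mul g 𝟘 x) v
xorSum-adj (g , w) (t ∷ x) zero = xorSum-lookup w x
xorSum-adj (g , w) (t ∷ x) (suc i)
  rewrite lookup-zipWith _xor_ i (t ⊙ w) (mul g 𝟘 x) | lookup-map i (t ∧_) w =
  cong₂ _xor_ (∧-comm (lookup w i) t) (xorSum-adj g x i)

odd-degIn : ∀ {n} (g : Graph n) (A : Subset n) v → odd (degIn g A v) ≡ lookup (mul g 𝟘 A) v
odd-degIn {n} g A v = trans (odd-length-filter n (λ u → adj g v u ∧ lookup A u) (λ u → u)) (xorSum-adj g A v)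

mul-diagonal : ∀ {n} (g : Graph n) (d x : Vec Bool n) → mul g d x ≡ mul g 𝟘 x ⊕ zipWith _∧_ d x
mul-diagonal {zero} g [] [] = refl
mul-diagonal {suc n} (g , v) (a ∷ d) (t ∷ x) = cong₂ _∷_ (xor-comm (a ∧ t) (v ∙ x))
  (trans (cong (t ⊙ v ⊕_) (mul-diagonal g d x)) (sym (⊕-assoc (t ⊙ v) _ _)))

lookup-ext : ∀ {n} (x y : Vec Bool n) → (∀ i → lookup x i ≡ lookup y i) → x ≡ y
lookup-ext [] [] _ = refl
lookup-ext (a ∷ x) (b ∷ y) eq = cong₂ _∷_ (eq zero) (lookup-ext x y (eq ∘ suc))

-- The degree parities, which are the diagonal of the Laplacian over 𝔽₂; `mul g (degrees g)` is
-- therefore the Laplacian itself.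
degrees : ∀ {n} → Graph n → Vec Bool n
degrees g = mul g 𝟘 𝟙

∁≡⊕𝟙 : ∀ {n} (A : Subset n) → ∁ A ≡ A ⊕ 𝟙
∁≡⊕𝟙 [] = refl
∁≡⊕𝟙 (a ∷ A) = cong₂ _∷_ (xor-comm true a) (∁≡⊕𝟙 A)

module _ {n} (g : Graph n) (A : Subset n) where

  private
    s o D : Fin n → Bool
    s = lookup A
    o = lookup (mul g 𝟘 A)
    D = lookup (degrees g)

    complement : ∀ v → lookup (mul g 𝟘 (∁ A)) v ≡ o v xor D v
    complement v rewrite ∁≡⊕𝟙 A | mul-⊕ g 𝟘 A 𝟙 = lookup-zipWith _xor_ v (mul g 𝟘 A) (degrees g)

    product : ∀ v → lookup (mul g (degrees g) A) v ≡ o v xor (D v ∧ s v)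
    product v rewrite mul-diagonal g (degrees g) A
      | lookup-zipWith _xor_ v (mul g 𝟘 A) (zipWith _∧_ (degrees g) A) | lookup-zipWith _∧_ v (degrees g) A = refl

    ∈∁ : ∀ v → s v ≡ false → v ∈ ∁ A
    ∈∁ v e = lookup⇒[]= v (∁ A) (trans (lookup-map v not A) (cong not e))

  goodPart⇒ : GoodPart g A → mul g (degrees g) A ≡ degrees g
  goodPart⇒ (inA , in∁A) = lookup-ext _ _ λ v → trans (product v) (coordinate v (s v) refl)
    where
    coordinate : ∀ v b → s v ≡ b → o v xor (D v ∧ b) ≡ D v
    coordinate v true e
      rewrite trans (sym (odd-degIn g A v)) (even⇒¬odd (inA v (lookup⇒[]= v A e))) = ∧-identityʳ _
    coordinate v false e = cancel (o v) (D v)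
      (trans (sym (complement v)) (trans (sym (odd-degIn g (∁ A) v)) (even⇒¬odd (in∁A v (∈∁ v e)))))
      where
      cancel : ∀ p q → p xor q ≡ false → p xor (q ∧ false) ≡ q
      cancel false false _ = refl
      cancel true true _ = refl

  goodPart⇐ : mul g (degrees g) A ≡ degrees g → GoodPart g A
  goodPart⇐ eq = inA , in∁A
    where
    coordinate : ∀ v → o v xor (D v ∧ s v) ≡ D v
    coordinate v = trans (sym (product v)) (cong (λ x → lookup x v) eq)
    inA : EvenInduced g A
    inA v v∈A = ¬odd⇒even _ (trans (odd-degIn g A v) (cancel (o v) (D v)
      (subst (λ b → o v xor (D v ∧ b) ≡ D v) ([]=⇒lookup v∈A) (coordinate v))))
      where
      cancel : ∀ p q → p xor (q ∧ true) ≡ q → p ≡ false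
      cancel false q _ = refl
      cancel true false ()
      cancel true true ()
    in∁A : EvenInduced g (∁ A)
    in∁A v v∈∁A = ¬odd⇒even _ (trans (odd-degIn g (∁ A) v) (trans (complement v) (cancel (o v) (D v) (s v)
      (trans (sym (lookup-map v not A)) ([]=⇒lookup v∈∁A)) (coordinate v))))
      where
      cancel : ∀ p q b → not b ≡ true → p xor (q ∧ b) ≡ q → p xor q ≡ false
      cancel false false false _ _ = refl
      cancel true true false _ _ = refl

X-diagonalSolutions : ∀ {m} (g : Graph m) (v : Vec Bool m) → X (g , v) ≡ diagonalSolutions g (v ⊕ degrees g)
X-diagonalSolutions {m} g v = begin
  length (filter (goodPart? G) (allVecs (suc m))) / 2    ≡⟨ cong (_/ 2) count ⟩
  (S + S) / 2                                            ≡⟨ cong (_/ 2) (trans (cong (S +_) (sym (+-identityʳ S))) (*-comm 2 S)) ⟩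
  S * 2 / 2                                              ≡⟨ m*n/n≡m S 2 ⟩
  S                                                      ∎
  where
  G : Graph (suc m)
  G = g , v
  d = v ⊕ degrees g
  S = diagonalSolutions g d
  degrees-G : degrees G ≡ (v ∙ 𝟙) ∷ d
  degrees-G = mul-true∷ g v false 𝟘 𝟙
  -- Deleting the row and column of vertex 0 from the Laplacian gives the matrix (g , d),
  -- which maps 𝟙 to the deleted column because the rows of the Laplacian sum to 0.
  row-sums : mul g d 𝟙 ≡ v
  row-sums = begin
    mul g d 𝟙                        ≡⟨ mul-diagonal g d 𝟙 ⟩
    degrees g ⊕ zipWith _∧_ d 𝟙      ≡⟨ cong (degrees g ⊕_) (zipWith-identityʳ ∧-identityʳ d) ⟩
    degrees g ⊕ (v ⊕ degrees g)      ≡⟨ cong (degrees g ⊕_) (⊕-comm v (degrees g)) ⟩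
    degrees g ⊕ (degrees g ⊕ v)      ≡⟨ ⊕-cancelˡ (degrees g) v ⟩
    v                                ∎
  count : length (filter (goodPart? G) (allVecs (suc m))) ≡ S + S
  count = begin
    length (filter (goodPart? G) (allVecs (suc m)))
      ≡⟨ length-filter≡∑ (goodPart? G) (allVecs (suc m)) ⟩
    ∑ (allVecs (suc m)) (λ A → ⟦ goodPart? G A ⟧)
      ≡⟨ ∑-cong (allVecs (suc m)) (λ A →
           ⟦⟧-cong (goodPart? G A) (mul G (degrees G) A ≟ᵛ degrees G) (goodPart⇒ G A) (goodPart⇐ G A)) ⟩
    diagonalSolutions G (degrees G)
      ≡⟨ cong (diagonalSolutions G) degrees-G ⟩
    diagonalSolutions G ((v ∙ 𝟙) ∷ d)
      -- The corner equals `v ∙ 𝟙`, the critical value for `y = 𝟙`, so this is the case in which the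
      -- count doubles.
      ≡⟨ extend-solvable g d v row-sums (v ∙ 𝟙) ⟩
    ⟦ v ∙ 𝟙 Data.Bool.≟ v ∙ 𝟙 ⟧ * S + S
      ≡⟨ cong (λ c → c * S + S) (⟦⟧-yes (v ∙ 𝟙 Data.Bool.≟ v ∙ 𝟙) refl) ⟩
    1 * S + S
      ≡⟨ cong (_+ S) (*-identityˡ S) ⟩
    S + S ∎

count-X : ∀ m q → length (filter (λ g → X g ≟ q) (allGraphs (suc m))) ≡ matrices m q
count-X m q = begin
  length (filter (λ g → X g ≟ q) (allGraphs (suc m)))
    ≡⟨ length-filter≡∑ (λ g → X g ≟ q) (allGraphs (suc m)) ⟩
  ∑ (allGraphs (suc m)) (λ g → ⟦ X g ≟ q ⟧)
    ≡⟨ ∑-allGraphs-suc m _ ⟩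
  ∑ₘ m (λ g v → ⟦ X (g , v) ≟ q ⟧)
    ≡⟨ ∑ₘ-cong m (λ g v → cong (λ s → ⟦ s ≟ q ⟧) (X-diagonalSolutions g v)) ⟩
  ∑ₘ m (λ g v → ⟦ diagonalSolutions g (v ⊕ degrees g) ≟ q ⟧)
    -- Uniformity: for fixed `g`, the diagonal `v ⊕ degrees g` runs through all vectors as `v` does.
    ≡⟨ ∑-cong (allGraphs m) (λ g → ∑-shift m (degrees g) (λ d → ⟦ diagonalSolutions g d ≟ q ⟧)) ⟩
  matrices m q ∎

-- The closed formula

-- Factors are peeled off at index 0, as in `applyUpTo`, so that the recursion runs parallel to
-- `prodFromTo`.
∏ : (ℕ → ℕ) → ℕ → ℕ
∏ f zero = 1
∏ f (suc n) = f 0 * ∏ (f ∘ suc) n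

∏-cong : ∀ n {f h : ℕ → ℕ} → (∀ i → f i ≡ h i) → ∏ f n ≡ ∏ h n
∏-cong zero eq = refl
∏-cong (suc n) eq = cong₂ _*_ (eq 0) (∏-cong n (eq ∘ suc))

∏-last : ∀ f n → ∏ f (suc n) ≡ ∏ f n * f n
∏-last f zero = *-comm (f 0) 1
∏-last f (suc n) = trans (cong (f 0 *_) (∏-last (f ∘ suc) n)) (sym (*-assoc (f 0) _ _))

mersenne-+ : ∀ k r → mersenne (k + r) ≡ mersenne k * 2 ^ r + mersenne r
mersenne-+ k r = suc-injective (begin
  1 + mersenne (k + r)                              ≡⟨ 1+mersenne (k + r) ⟩
  2 ^ (k + r)                                       ≡⟨ ^-distribˡ-+-* 2 k r ⟩
  2 ^ k * 2 ^ r                                     ≡⟨ cong (_* 2 ^ r) (1+mersenne k) ⟨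
  2 ^ r + mersenne k * 2 ^ r                        ≡⟨ cong (_+ mersenne k * 2 ^ r) (1+mersenne r) ⟨
  1 + mersenne r + mersenne k * 2 ^ r               ≡⟨ cong suc (+-comm (mersenne r) _) ⟩
  1 + (mersenne k * 2 ^ r + mersenne r)             ∎)

-- Denominator of the product of the factors 1 / (1 - 2 ^ (-2i)) for 1 ≤ i ≤ s; `evenPowers` is the
-- numerator.
evenMersennes : ℕ → ℕ
evenMersennes = ∏ (λ i → mersenne (2 * suc i))

evenPowers : ℕ → ℕ
evenPowers = ∏ (λ i → 2 ^ (2 * suc i))

mersennes : ℕ → ℕ → ℕ
mersennes k = ∏ (λ i → mersenne (k + 1 + i))

mersennes-first : ∀ k r → mersennes k (suc r) ≡ mersenne (suc k) * mersennes (suc k) r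
mersennes-first k r = cong₂ _*_ (cong mersenne (trans (+-identityʳ _) (+-comm k 1)))
  (∏-cong r (λ i → cong mersenne (+-suc (k + 1) i)))

mersennes-last : ∀ k r → mersennes k (suc r) ≡ mersennes k r * (mersenne k * 2 ^ suc r + mersenne (suc r))
mersennes-last k r = trans (∏-last _ r)
  (cong (mersennes k r *_) (trans (cong mersenne (+-assoc k 1 r)) (mersenne-+ k (suc r))))

-- The classical count of symmetric matrices over 𝔽₂ of size n and rank `r`, with denominators
-- cleared. `s` is tied to `r` by an equation so that each parity case can supply it in reduced
-- form.
MatrixFormula : ℕ → Set
MatrixFormula n = ∀ r k s → r + k ≡ n → ⌊ r /2⌋ ≡ s →
  matrices n (2 ^ k) * evenMersennes s ≡ evenPowers s * mersennes k r

module _ {n} (formula : MatrixFormula n) where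

  -- This and the next two lemmas bring the three contributions to the common product of 2 ^ i - 1
  -- over k < i ≤ n. The extra factor `mersenne k` comes from starting at nullity k - 1, and it is 0
  -- for k = 0, where nothing can be raised to nullity 0.
  up-formula : ∀ r k s → r + k ≡ n → ⌊ suc r /2⌋ ≡ s →
    nullity-up n (2 ^ k) * evenMersennes s ≡ 2 ^ suc r * evenPowers s * (mersenne k * mersennes k r)
  up-formula r zero s _ _ = trans (cong (_* evenMersennes s) (nullity-up-zero n))
    (sym (*-zeroʳ (2 ^ suc r * evenPowers s)))
  up-formula r (suc k) s r+k half = begin
    nullity-up n (2 ^ suc k) * D                                ≡⟨ cong (_* D) (nullity-up-suc (suc r) k eq) ⟩
    2 ^ suc r * matrices n (2 ^ k) * D                          ≡⟨ *-assoc (2 ^ suc r) _ _ ⟩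
    2 ^ suc r * (matrices n (2 ^ k) * D)                        ≡⟨ cong (2 ^ suc r *_) (formula (suc r) k s eq half) ⟩
    2 ^ suc r * (E * mersennes k (suc r))                       ≡⟨ *-assoc (2 ^ suc r) E _ ⟨
    2 ^ suc r * E * mersennes k (suc r)                         ≡⟨ cong (2 ^ suc r * E *_) (mersennes-first k r) ⟩
    2 ^ suc r * E * (mersenne (suc k) * mersennes (suc k) r)    ∎
    where
    D = evenMersennes s
    E = evenPowers s
    eq : suc r + k ≡ n
    eq = trans (sym (+-suc r k)) r+k

  same-formula : ∀ r k s → r + k ≡ n → ⌊ r /2⌋ ≡ s →
    nullity-same n (2 ^ k) * evenMersennes s ≡ 2 ^ r * evenPowers s * mersennes k r
  same-formula r k s r+k half = begin
    nullity-same n (2 ^ k) * evenMersennes s         ≡⟨ cong (_* evenMersennes s) (nullity-same-2^ r k r+k) ⟩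
    2 ^ r * matrices n (2 ^ k) * evenMersennes s     ≡⟨ *-assoc (2 ^ r) _ _ ⟩
    2 ^ r * (matrices n (2 ^ k) * evenMersennes s)   ≡⟨ cong (2 ^ r *_) (formula r k s r+k half) ⟩
    2 ^ r * (evenPowers s * mersennes k r)           ≡⟨ *-assoc (2 ^ r) _ _ ⟨
    2 ^ r * evenPowers s * mersennes k r             ∎

  down-formula : ∀ r k s → suc r + k ≡ n → ⌊ r /2⌋ ≡ s →
    nullity-down n (2 ^ k) * evenMersennes s ≡ 2 ^ r * evenPowers s * mersennes k (suc r)
  down-formula r k s r+k half = begin
    nullity-down n (2 ^ k) * D                       ≡⟨ cong (_* D) (nullity-down-2^ r k eq) ⟩
    2 ^ r * M * matrices n (2 ^ suc k) * D           ≡⟨ *-assoc (2 ^ r * M) _ D ⟩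
    2 ^ r * M * (matrices n (2 ^ suc k) * D)         ≡⟨ cong (2 ^ r * M *_) (formula r (suc k) s eq half) ⟩
    2 ^ r * M * (E * mersennes (suc k) r)
      ≡⟨ solve 4 (λ z M E p → z :* M :* (E :* p) := z :* E :* (M :* p)) refl (2 ^ r) M E (mersennes (suc k) r) ⟩
    2 ^ r * E * (M * mersennes (suc k) r)            ≡⟨ cong (2 ^ r * E *_) (mersennes-first k r) ⟨
    2 ^ r * E * mersennes k (suc r)                  ∎
    where
    open +-*-Solver using (solve; _:*_; _:=_)
    D = evenMersennes s
    E = evenPowers s
    M = mersenne (suc k)
    eq : r + suc k ≡ n
    eq = trans (+-suc r k) r+k

-- Zero is kept apart from the positive even numbers: for `r ≡ 0` the recursion has no term that
-- lowers the nullity. In the other cases the leading `suc` exposes the rank `r - 1` from which that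
-- term starts.
parity : ∀ r → r ≡ 0 ⊎ (∃ λ t → r ≡ suc (t + t)) ⊎ (∃ λ t → r ≡ suc (suc (t + t)))
parity zero = inj₁ refl
parity (suc zero) = inj₂ (inj₁ (0 , refl))
parity (suc (suc r)) with parity r
... | inj₁ refl = inj₂ (inj₂ (0 , refl))
... | inj₂ (inj₁ (t , refl)) = inj₂ (inj₁ (suc t , cong (2 +_) (sym (+-suc t t))))
... | inj₂ (inj₂ (t , refl)) = inj₂ (inj₂ (suc t , cong (3 +_) (sym (+-suc t t))))

2*suc : ∀ t → 2 * suc t ≡ suc (suc (t + t))
2*suc t = cong suc (trans (cong (t +_) (+-identityʳ (suc t))) (+-suc t t))

-- The recursion for extensions by one row, cleared of denominators: U, S, N count the extensions
-- raising, keeping and lowering the nullity, D′ / D = u = 2 ^ i - 1 and E′ / E = 2 ^ i = 4 z, where i is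
-- the even one of r and r + 1, and v = 2 ^ k - 1.
module _ (z u v D E P U S N : ℕ) {D′ E′ : ℕ} where
  open +-*-Solver using (solve; _:*_; _:+_; _:=_; con)

  private
    w = 2 * (2 * z)

  combine-odd : D′ ≡ D * u → E′ ≡ E * w →
    U * D′ ≡ w * E′ * (v * P) → S * D ≡ 2 * z * E * P → N * D ≡ z * E * P →
    (U + S + 2 * N) * D′ ≡ E′ * (P * (v * w + u))
  combine-odd refl refl hU hS hN = begin
    (U + S + 2 * N) * (D * u)
      ≡⟨ solve 5 (λ U S N D u → (U :+ S :+ con 2 :* N) :* (D :* u)
           := U :* (D :* u) :+ S :* D :* u :+ con 2 :* (N :* D) :* u) refl U S N D u ⟩
    U * (D * u) + S * D * u + 2 * (N * D) * u
      ≡⟨ cong₂ _+_ (cong₂ _+_ hU (cong (_* u) hS)) (cong (λ x → 2 * x * u) hN) ⟩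
    w * (E * w) * (v * P) + 2 * z * E * P * u + 2 * (z * E * P) * u
      ≡⟨ solve 5 (λ z E v P u → let w = con 2 :* (con 2 :* z) in
             w :* (E :* w) :* (v :* P) :+ con 2 :* z :* E :* P :* u :+ con 2 :* (z :* E :* P) :* u
           := E :* w :* (P :* (v :* w :+ u))) refl z E v P u ⟩
    E * w * (P * (v * w + u)) ∎

  combine-even : D′ ≡ D * u → E′ ≡ E * w →
    U * D′ ≡ 2 * w * E′ * (v * P) → S * D′ ≡ w * E′ * P → N * D ≡ 2 * z * E * P →
    (U + S + 2 * N) * D′ ≡ E′ * (P * (v * (2 * w) + (w + u)))
  combine-even refl refl hU hS hN = begin
    (U + S + 2 * N) * (D * u)
      ≡⟨ solve 5 (λ U S N D u → (U :+ S :+ con 2 :* N) :* (D :* u)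
           := U :* (D :* u) :+ S :* (D :* u) :+ con 2 :* (N :* D) :* u) refl U S N D u ⟩
    U * (D * u) + S * (D * u) + 2 * (N * D) * u
      ≡⟨ cong₂ _+_ (cong₂ _+_ hU hS) (cong (λ x → 2 * x * u) hN) ⟩
    2 * w * (E * w) * (v * P) + w * (E * w) * P + 2 * (2 * z * E * P) * u
      ≡⟨ solve 5 (λ z E v P u → let w = con 2 :* (con 2 :* z) in
             con 2 :* w :* (E :* w) :* (v :* P) :+ w :* (E :* w) :* P :+ con 2 :* (con 2 :* z :* E :* P) :* u
           := E :* w :* (P :* (v :* (con 2 :* w) :+ (w :+ u)))) refl z E v P u ⟩
    E * w * (P * (v * (2 * w) + (w + u))) ∎

evenMersennes-suc : ∀ t → evenMersennes (suc t) ≡ evenMersennes t * mersenne (suc (suc (t + t)))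
evenMersennes-suc t = trans (∏-last _ t) (cong (λ i → evenMersennes t * mersenne i) (2*suc t))

evenPowers-suc : ∀ t → evenPowers (suc t) ≡ evenPowers t * 2 ^ suc (suc (t + t))
evenPowers-suc t = trans (∏-last _ t) (cong (λ i → evenPowers t * 2 ^ i) (2*suc t))

mersenne-suc : ∀ n → mersenne (suc n) ≡ 2 ^ n + mersenne n
mersenne-suc n = trans (mersenne-+ 1 n) (cong (_+ mersenne n) (*-identityˡ (2 ^ n)))

matrixFormula-suc : ∀ {n} → MatrixFormula n → MatrixFormula (suc n)
-- Rank 0: nullity `suc n` arises only by raising nullity `n`.
matrixFormula-suc {n} formula zero .(suc n) .0 refl refl = begin
  matrices (suc n) (2 ^ suc n) * 1                                       ≡⟨ *-identityʳ _ ⟩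
  matrices (suc n) (2 ^ suc n)                                           ≡⟨ matrices-suc n (2 ^ suc n) ⟩
  nullity-up n (2 ^ suc n) + nullity-same n (2 ^ suc n) + 2 * nullity-down n (2 ^ suc n)
    ≡⟨ cong₂ (λ x y → nullity-up n (2 ^ suc n) + x + 2 * y)
         (nullity-same-large {n} ≤-refl) (nullity-down-large {n} {suc n} (m≤n⇒m≤1+n ≤-refl)) ⟩
  nullity-up n (2 ^ suc n) + 0 + 0                                       ≡⟨ trans (+-identityʳ _) (+-identityʳ _) ⟩
  nullity-up n (2 ^ suc n)                                               ≡⟨ nullity-up-suc 0 n refl ⟩
  1 * matrices n (2 ^ n)                                                 ≡⟨ *-comm 1 (matrices n (2 ^ n)) ⟩
  matrices n (2 ^ n) * 1                                                 ≡⟨ formula 0 n 0 refl refl ⟩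
  1                                                                      ∎
matrixFormula-suc {n} formula (suc r) k s r+k h =
  trans (cong (_* evenMersennes s) (matrices-suc n (2 ^ k)))
    (trans (step r s (suc-injective r+k) h (parity r)) (cong (evenPowers s *_) (sym (mersennes-last k r))))
  where
  open +-*-Solver using (solve; _:*_; _:+_; _:=_; con)
  U = nullity-up n (2 ^ k)
  S = nullity-same n (2 ^ k)
  N = nullity-down n (2 ^ k)
  step : ∀ r s → r + k ≡ n → ⌊ suc r /2⌋ ≡ s →
    r ≡ 0 ⊎ (∃ λ t → r ≡ suc (t + t)) ⊎ (∃ λ t → r ≡ suc (suc (t + t))) →
    (U + S + 2 * N) * evenMersennes s
    ≡ evenPowers s * (mersennes k r * (mersenne k * 2 ^ suc r + mersenne (suc r)))
  step r s eq refl (inj₁ refl) = begin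
    (U + S + 2 * N) * 1
      ≡⟨ cong (λ x → (U + S + 2 * x) * 1) (nullity-down-large {n} {k} (≤-reflexive (cong suc (sym eq)))) ⟩
    (U + S + 0) * 1
      ≡⟨ solve 2 (λ U S → (U :+ S :+ con 0) :* con 1 := U :* con 1 :+ S :* con 1) refl U S ⟩
    U * 1 + S * 1
      ≡⟨ cong₂ _+_ (up-formula formula 0 k 0 eq refl) (same-formula formula 0 k 0 eq refl) ⟩
    2 * (mersenne k * 1) + 1
      ≡⟨ solve 1 (λ v → con 2 :* (v :* con 1) :+ con 1 := con 1 :* (con 1 :* (v :* con 2 :+ con 1))) refl (mersenne k) ⟩
    1 * (1 * (mersenne k * 2 + 1)) ∎
  -- The terms `U`, `S`, `N` come from ranks r + 1, r, r - 1, here 2t + 2, 2t + 1, 2t, with halves t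
  -- + 1, t, t. Hence `U` is known over the larger denominator only.
  step r s eq half (inj₂ (inj₁ (t , refl)))
    with refl ← trans (cong suc (n≡⌊n+n/2⌋ t)) half =
    combine-odd (2 ^ (t + t)) (mersenne (suc (suc (t + t)))) (mersenne k) (evenMersennes t) (evenPowers t)
      (mersennes k (suc (t + t))) U S N (evenMersennes-suc t) (evenPowers-suc t)
      (up-formula formula (suc (t + t)) k (suc t) eq half)
      (same-formula formula (suc (t + t)) k t eq (sym (n≡⌈n+n/2⌉ t)))
      (down-formula formula (t + t) k t eq (sym (n≡⌊n+n/2⌋ t)))
  -- The ranks are now 2t + 3, 2t + 2, 2t + 1 with halves t + 1, t + 1, t, so `S` moves to the
  -- larger denominator.
  step r s eq half (inj₂ (inj₂ (t , refl)))
    with refl ← trans (cong suc (n≡⌈n+n/2⌉ t)) half =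
    trans
      (combine-even (2 ^ (t + t)) (mersenne (suc (suc (t + t)))) (mersenne k) (evenMersennes t) (evenPowers t)
        (mersennes k (suc (suc (t + t)))) U S N (evenMersennes-suc t) (evenPowers-suc t)
        (up-formula formula (suc (suc (t + t))) k (suc t) eq half)
        (same-formula formula (suc (suc (t + t))) k (suc t) eq (cong suc (sym (n≡⌊n+n/2⌋ t))))
        (down-formula formula (suc (t + t)) k t eq (sym (n≡⌈n+n/2⌉ t))))
      (cong (λ x → evenPowers (suc t) * (mersennes k (suc (suc (t + t))) * (mersenne k * 2 ^ suc (suc (suc (t + t))) + x)))
        (sym (mersenne-suc (suc (suc (t + t))))))

matrixFormula : ∀ n → MatrixFormula n
matrixFormula zero zero zero .0 refl refl = refl
matrixFormula (suc n) = matrixFormula-suc (matrixFormula n)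

-- Probabilities

-- Euclid's lemma strips one factor 2 at a time. With `range*solutions` it shows that every solution
-- count is a power of two, without a basis of the kernel.
factor-of-2^ : ∀ m a b → a * b ≡ 2 ^ m → ∃ λ k → k ≤ m × b ≡ 2 ^ k
factor-of-2^ zero a b e = 0 , z≤n , m*n≡1⇒n≡1 a b e
factor-of-2^ (suc m) a b e with euclidsLemma a b prime[2] (divides (2 ^ m) (trans e (*-comm 2 (2 ^ m))))
... | inj₁ (divides a′ refl) with k , k≤m , b≡ ← factor-of-2^ m a′ b
        (*-cancelˡ-≡ (a′ * b) (2 ^ m) 2 (trans (trans (sym (*-assoc 2 a′ b)) (cong (_* b) (*-comm 2 a′))) e)) =
  k , m≤n⇒m≤1+n k≤m , b≡
... | inj₂ (divides b′ refl) with k , k≤m , b≡ ← factor-of-2^ m a b′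
        (*-cancelˡ-≡ (a * b′) (2 ^ m) 2 (trans (trans (*-comm 2 (a * b′)) (*-assoc a b′ 2)) e)) =
  suc k , s≤s k≤m , trans (*-comm b′ 2) (cong (2 *_) b≡)

matrices-non-power : ∀ m x → (∀ k → k < suc m → x ≢ 2 ^ k) → matrices m x ≡ 0
matrices-non-power m x x≢ = ∑ₘ-zero m λ g d → ⟦⟧-no (diagonalSolutions g d ≟ x) λ e →
  let k , k≤m , S≡ = factor-of-2^ m (range g d) (diagonalSolutions g d) (range*solutions g d)
  in x≢ k (s≤s k≤m) (trans (sym e) S≡)

half≡ : ∀ n → n / 2 ≡ ⌊ n /2⌋
half≡ zero = refl
half≡ (suc zero) = refl
half≡ (suc (suc n)) = trans (m/n≡1+[m∸n]/n {suc (suc n)} {2} (s≤s (s≤s z≤n))) (cong suc (half≡ n))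

-- Clearing denominators in ℚ

ι : ℕ → ℚ
ι n = ℤ.+ n ℚ./ 1

toℚᵘ-/ : ∀ a b → toℚᵘ (ℤ.+ a ℚ./ suc b) ≃ᵘ mkℚᵘ (ℤ.+ a) b
toℚᵘ-/ a b = ℚ.toℚᵘ-fromℚᵘ (mkℚᵘ (ℤ.+ a) b)

/-*-ι : ∀ a b .{{_ : NonZero b}} → (ℤ.+ a ℚ./ b) *ℚ ι b ≡ ι a
/-*-ι a (suc b) = ℚ.toℚᵘ-injective (ℚᵘ.≃-trans (ℚ.toℚᵘ-homo-* (ℤ.+ a ℚ./ suc b) (ι (suc b)))
  (ℚᵘ.≃-trans (ℚᵘ.*-cong (toℚᵘ-/ a b) (toℚᵘ-/ (suc b) 0))
  (ℚᵘ.≃-trans (*≡* cross) (ℚᵘ.≃-sym (toℚᵘ-/ a 0)))))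
  where
  cross : (ℤ.+ a ℤ.* ℤ.+ suc b) ℤ.* ℤ.+ 1 ≡ ℤ.+ a ℤ.* ℤ.+ (suc b * 1)
  cross = trans (ℤ.*-identityʳ _) (cong (λ c → ℤ.+ a ℤ.* ℤ.+ c) (sym (*-identityʳ (suc b))))

ι-* : ∀ a b → ι (a * b) ≡ ι a *ℚ ι b
ι-* a b = sym (ℚ.toℚᵘ-injective (ℚᵘ.≃-trans (ℚ.toℚᵘ-homo-* (ι a) (ι b))
  (ℚᵘ.≃-trans (ℚᵘ.*-cong (toℚᵘ-/ a 0) (toℚᵘ-/ b 0))
  (ℚᵘ.≃-trans (*≡* (cong (ℤ._* ℤ.+ 1) (sym (ℤ.pos-* a b)))) (ℚᵘ.≃-sym (toℚᵘ-/ (a * b) 0))))))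

ι-cancelʳ : ∀ c .{{_ : NonZero c}} {p q} → p *ℚ ι c ≡ q *ℚ ι c → p ≡ q
ι-cancelʳ c e = ℚ.≤-antisym
  (ℚ.*-cancelʳ-≤-pos (ι c) {{ℚ.normalize-pos c 1}} (ℚ.≤-reflexive e))
  (ℚ.*-cancelʳ-≤-pos (ι c) {{ℚ.normalize-pos c 1}} (ℚ.≤-reflexive (sym e)))

-- Each `f (h i)` is the fraction `a i / b i`. The index map `h` is general because `applyUpTo`
-- recurses by precomposing with `suc`.
∏-clear : (f : ℕ → ℚ) (h a b : ℕ → ℕ) → (∀ i → f (h i) *ℚ ι (b i) ≡ ι (a i)) → ∀ n →
  foldr _*ℚ_ 1ℚ (List.map f (applyUpTo h n)) *ℚ ι (∏ b n) ≡ ι (∏ a n)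
∏-clear f h a b clear zero = refl
∏-clear f h a b clear (suc n) = begin
  (f (h 0) *ℚ F) *ℚ ι (b 0 * B)              ≡⟨ cong ((f (h 0) *ℚ F) *ℚ_) (ι-* (b 0) B) ⟩
  (f (h 0) *ℚ F) *ℚ (ι (b 0) *ℚ ι B)
    ≡⟨ solve 4 (λ x y z w → (x :* y) :* (z :* w) := (x :* z) :* (y :* w)) refl (f (h 0)) F (ι (b 0)) (ι B) ⟩
  (f (h 0) *ℚ ι (b 0)) *ℚ (F *ℚ ι B)         ≡⟨ cong₂ _*ℚ_ (clear 0) (∏-clear f (h ∘ suc) (a ∘ suc) (b ∘ suc) (clear ∘ suc) n) ⟩
  ι (a 0) *ℚ ι (∏ (a ∘ suc) n)               ≡⟨ ι-* (a 0) _ ⟨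
  ι (∏ a (suc n))                            ∎
  where
  open ℚ.+-*-Solver using (solve; _:*_; _:=_)
  F = foldr _*ℚ_ 1ℚ (List.map f (applyUpTo (h ∘ suc) n))
  B = ∏ (b ∘ suc) n

mersenne-nonZero : ∀ i → NonZero (mersenne (suc i))
mersenne-nonZero i = >-nonZero (∸-monoˡ-≤ 1 (^-monoʳ-≤ 2 {1} {suc i} (s≤s z≤n)))

∏-nonZero : ∀ f → (∀ i → NonZero (f i)) → ∀ n → NonZero (∏ f n)
∏-nonZero f nz zero = _
∏-nonZero f nz (suc n) = m*n≢0 (f 0) (∏ (f ∘ suc) n) {{nz 0}} {{∏-nonZero (f ∘ suc) (nz ∘ suc) n}}

invFactors-clear : ∀ s → prodFromTo 1 s invFactor *ℚ ι (evenMersennes s) ≡ ι (evenPowers s)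
invFactors-clear = ∏-clear invFactor suc _ _ (λ i → /-*-ι (2 ^ (2 * suc i)) (mersenne (2 * suc i)) {{mersenne-nonZero (i + suc (i + 0))}})

twoPowMinusOnes : ∀ r k → prodFromTo (k + 1) (r + k) twoPowMinusOne ≡ ι (mersennes k r)
twoPowMinusOnes r k = begin
  prodFromTo (k + 1) (r + k) twoPowMinusOne    ≡⟨ cong (foldr _*ℚ_ 1ℚ ∘ List.map twoPowMinusOne ∘ applyUpTo (λ j → k + 1 + j)) len ⟩
  F                                            ≡⟨ ℚ.*-identityʳ F ⟨
  F *ℚ ι 1                                     ≡⟨ cong (λ c → F *ℚ ι c) (∏-one r) ⟨
  F *ℚ ι (∏ (λ _ → 1) r)
    ≡⟨ ∏-clear twoPowMinusOne (λ j → k + 1 + j) (λ i → mersenne (k + 1 + i)) (λ _ → 1) (λ i → ℚ.*-identityʳ _) r ⟩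
  ι (mersennes k r)                            ∎
  where
  F = foldr _*ℚ_ 1ℚ (List.map twoPowMinusOne (applyUpTo (λ j → k + 1 + j) r))
  len : suc (r + k) ∸ (k + 1) ≡ r
  len = trans (cong (_∸ (k + 1)) (trans (sym (+-suc r k)) (cong (r +_) (+-comm 1 k)))) (m+n∸n≡m r (k + 1))
  ∏-one : ∀ r → ∏ (λ _ → 1) r ≡ 1
  ∏-one zero = refl
  ∏-one (suc r) = trans (*-identityˡ _) (∏-one r)

clear-denominators : ∀ N W D E M {Q R} .{{_ : NonZero W}} .{{_ : NonZero D}} →
  N * D ≡ E * M → Q *ℚ ι D ≡ ι E → R ≡ ι M → ℤ.+ N ℚ./ W ≡ (ℤ.+ 1 ℚ./ W) *ℚ Q *ℚ R
clear-denominators N W D E M {Q} {R} eq hQ hR = ι-cancelʳ W (ι-cancelʳ D (begin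
  (ℤ.+ N ℚ./ W) *ℚ ι W *ℚ ι D      ≡⟨ cong (_*ℚ ι D) (/-*-ι N W) ⟩
  ι N *ℚ ι D                       ≡⟨ ι-* N D ⟨
  ι (N * D)                        ≡⟨ cong ι eq ⟩
  ι (E * M)                        ≡⟨ ι-* E M ⟩
  ι E *ℚ ι M                       ≡⟨ cong₂ _*ℚ_ hQ hR ⟨
  Q *ℚ ι D *ℚ R                    ≡⟨ ℚ.*-identityˡ _ ⟨
  1ℚ *ℚ (Q *ℚ ι D *ℚ R)            ≡⟨ cong (_*ℚ (Q *ℚ ι D *ℚ R)) (/-*-ι 1 W) ⟨
  T *ℚ ι W *ℚ (Q *ℚ ι D *ℚ R)
    ≡⟨ solve 5 (λ T W Q D R → T :* W :* (Q :* D :* R) := T :* Q :* R :* W :* D) refl T (ι W) Q (ι D) R ⟩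
  T *ℚ Q *ℚ R *ℚ ι W *ℚ ι D        ∎))
  where
  open ℚ.+-*-Solver using (solve; _:*_; _:=_)
  T = ℤ.+ 1 ℚ./ W

-- The equations for `m`, `r` and `s` keep truncated subtraction and division by 2 out of the
-- argument until it is instantiated.
PrX-power : ∀ {n m} r k s → suc m ≡ n → r + k ≡ m → ⌊ r /2⌋ ≡ s → PrX≡ n (2 ^ k) ≡
  twoPowNeg (n C 2) *ℚ prodFromTo 1 s invFactor *ℚ prodFromTo (k + 1) m twoPowMinusOne
PrX-power {n} {m} r k s refl refl half = clear-denominators
  (length (filter (λ g → X g ≟ 2 ^ k) (allGraphs n))) (2 ^ (n C 2))
  (evenMersennes s) (evenPowers s) (mersennes k r)
  {{m^n≢0 2 (n C 2)}} {{∏-nonZero _ (λ i → mersenne-nonZero (i + suc (i + 0))) s}}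
  (trans (cong (_* evenMersennes s) (count-X m (2 ^ k))) (matrixFormula m r k s refl half))
  (invFactors-clear s) (twoPowMinusOnes r k)

PrX-non-power : ∀ n → 1 ≤ n → ∀ x → (∀ k → k < n → x ≢ 2 ^ k) → PrX≡ n x ≡ 0ℚ
PrX-non-power n@(suc m) _ x x≢ = trans
  (cong (λ c → ℚ._/_ (ℤ.+ c) (2 ^ (n C 2)) {{m^n≢0 2 (n C 2)}}) (trans (count-X m x) (matrices-non-power m x x≢)))
  (ℚ.0/n≡0 (2 ^ (n C 2)) {{m^n≢0 2 (n C 2)}})

theorem5p3 : (n : ℕ) → 1 ≤ n →
    ((k : ℕ) → k < n →
    PrX≡ n (2 ^ k) ≡
    twoPowNeg (n C 2)
    *ℚ prodFromTo 1 ((n ∸ 1 ∸ k) / 2) invFactor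
    *ℚ prodFromTo (k + 1) (n ∸ 1) twoPowMinusOne)
    × ((x : ℕ) → ((k : ℕ) → k < n → x ≢ 2 ^ k) → PrX≡ n x ≡ 0ℚ)
theorem5p3 n 1≤n =
  (λ k k<n → PrX-power {n} {n ∸ 1} (n ∸ 1 ∸ k) k ((n ∸ 1 ∸ k) / 2)
    (m+[n∸m]≡n 1≤n) (m∸n+n≡m (∸-monoˡ-≤ 1 k<n)) (sym (half≡ (n ∸ 1 ∸ k)))) ,
  PrX-non-power n 1≤n
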